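{- Let $k\ge2$, $m\ge0$, $1\le s\le k$, and $N=mk+s$. For vincular patterns of length three in which exactly the last two letters are required to be adjacent, the numbers of avoiding permutations in $\mathcal{D}_{mk+s,k}$ are as follows. (1) $|\mathcal{D}_{N,k}(1\underline{23})|=0$ if $k\ge3$ and $N\ge3$; otherwise $|\mathcal{D}_{N,k}(1\underline{23})|=\operatorname{LE}(P^{123}_{m,s,k})$, where $P^{123}_{m,s,k}$ is the poset obtained from the block poset $B_{m,s,k}$ by adding, for every adjacent ascent pair $x_{i,a}<x_{i,a+1}$ (two consecutive positions of the same block), the relations $x_{i,a}<y$ for every position $y$ earlier than $x_{i,a}$. (2) $|\mathcal{D}_{N,k}(1\underline{32})|=\frac{1}{m!}\prod_{j=1}^{m}\binom{s+jk-1}{k}$. (3) $|\mathcal{D}_{N,k}(2\underline{13})|=\frac{1}{(k-1)(m+1)+1}\binom{k(m+1)}{m+1}$. (4) $|\mathcal{D}_{N,k}(2\underline{31})|=\frac{s}{mk+s}\binom{mk+s}{m}$. (5) $|\mathcal{D}_{N,k}(3\underline{12})|=k^m\,m!$. (6) $|\mathcal{D}_{N,k}(3\underline{21})|=\operatorname{LE}(P^{321\prime}_{m,s,k})$, where $P^{321\prime}_{m,s,k}$ is the poset obtained from $B_{m,s,k}$ by adding, for every boundary descent $x_{i,k}>x_{i+1,1}$ ($1\le i\le m$), the relations $y<x_{i,k}$ for every position $y$ earlier than $x_{i,k}$.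
   Context: For $\pi=\pi_1\cdots\pi_N\in S_N$ let $\operatorname{Des}(\pi)=\{i\in[N-1]:\pi_i>\pi_{i+1}\}$. For $k\ge2$, $N\ge1$, let $\mathcal{D}_{N,k}=\{\pi\in S_N:\operatorname{Des}(\pi)=\{k,2k,\ldots,k\lfloor (N-1)/k\rfloor\}\}$. For $abc\in S_3$, $\pi$ contains the vincular pattern $a\underline{bc}$ if there are positions $i<j<j+1$ such that $\pi_i\pi_j\pi_{j+1}$ has the same relative order as $abc$; otherwise it avoids it. $\mathcal{D}_{N,k}(p)$ is the set of elements of $\mathcal{D}_{N,k}$ avoiding $p$. Empty products equal $1$. Write $N=mk+s$ with $1\le s\le k$, and split the positions $1,\ldots,N$ from left to right into $m$ blocks of length $k$ followed by a last block of length $s$; $x_{i,a}$ is the $a$-th position of the $i$-th block ($1\le a\le k$ for $i\le m$, $1\le a\le s$ for $i=m+1$). The block poset $B_{m,s,k}$ on the elements $x_{i,a}$ is generated by $x_{i,a}<x_{i,a+1}$ inside each block and $x_{i+1,1}<x_{i,k}$ for $1\le i\le m$. "Adding relations" to a poset means taking the transitive closure. "Left/right/earlier" refer to the order of positions $1,\ldots,N$. $\operatorname{LE}(P)$ is the number of linear extensions of a finite poset $P$. -}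

module Defs where

open import Data.Fin.Base as Fin using (Fin; toℕ)
open import Data.Fin.Permutation using (Permutation′; _⟨$⟩ʳ_)
open import Data.Fin.Properties using (toℕ<n)
open import Data.List.Base using (applyUpTo; product)
open import Data.Nat.Base
open import Data.Nat.DivMod
open import Data.Nat.Properties
open import Data.Product.Base using (Σ; ∃-syntax; _×_; _,_; proj₁; proj₂)
open import Data.Sum.Base using (_⊎_; inj₁; inj₂)
open import Data.Vec.Base using (Vec; []; _∷_; lookup)
open import Function.Base using (_∘_)
open import Function.Bundles using (Inverse; _⇔_)
open import Level using (0ℓ)
open import Relation.Binary.Bundles using (Setoid)
open import Relation.Binary.Construct.Closure.Transitive using (TransClosure; [_]; _∷_; transitive)
import Relation.Binary.Construct.On as On
open import Relation.Binary.Construct.Union using (_∪_)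
open import Relation.Binary.Core using (Rel)
open import Relation.Binary.PropositionalEquality
open import Relation.Binary.Structures using (IsStrictPartialOrder)
open import Relation.Nullary.Decidable using (yes; no)
open import Relation.Nullary.Negation using (¬_; contradiction)
open import Relation.Unary using (Pred; _≐_; _∩_)

------------------------------------------------------------------------
-- Cardinality

-- Permutations are compared by their values: without function
-- extensionality, propositional equality on `Permutation′ N` is too fine.
⟪_⟫ : ∀ {N} → Pred (Permutation′ N) 0ℓ → Setoid 0ℓ 0ℓ
⟪_⟫ {N} S = On.setoid {B = Σ (Permutation′ N) S} (Fin N →-setoid Fin N) (λ π i → proj₁ π ⟨$⟩ʳ i)

infix 4 ∣_∣≡_
∣_∣≡_ : ∀ {N} → Pred (Permutation′ N) 0ℓ → ℕ → Set
∣ S ∣≡ n = Inverse ⟪ S ⟫ (setoid (Fin n))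

------------------------------------------------------------------------
-- Descents and vincular patterns

-- The one-line word of π is π ⟨$⟩ʳ 0, π ⟨$⟩ʳ 1, …; values start from 0,
-- which does not affect their relative order, whereas positions are
-- numbered from 1 by `pos`.
pos : ∀ {N} → Fin N → ℕ
pos p = suc (toℕ p)

Des : ∀ {N} → Permutation′ N → Pred ℕ 0ℓ
Des π i = ∃[ p ] ∃[ q ] pos p ≡ i × pos q ≡ suc i × π ⟨$⟩ʳ p Fin.> π ⟨$⟩ʳ q

𝓓 : ∀ N k .{{_ : NonZero k}} → Pred (Permutation′ N) 0ℓ
𝓓 N k π = Des π ≐ λ i → ∃[ j ] 1 ≤ j × j ≤ (N ∸ 1) / k × i ≡ j * k

SameOrder : ∀ {n} → Vec ℕ n → Vec ℕ n → Set
SameOrder v w = ∀ a b → lookup v a < lookup v b ⇔ lookup w a < lookup w b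

-- Containment of the vincular pattern whose last two letters are adjacent.
Contains : ∀ {N} → Vec ℕ 3 → Pred (Permutation′ N) 0ℓ
Contains p π = ∃[ i ] ∃[ j ] ∃[ j⁺ ] i Fin.< j × pos j⁺ ≡ suc (pos j) ×
  SameOrder p (toℕ (π ⟨$⟩ʳ i) ∷ toℕ (π ⟨$⟩ʳ j) ∷ toℕ (π ⟨$⟩ʳ j⁺) ∷ [])

𝓓⟨_⟩ : Vec ℕ 3 → ∀ N k .{{_ : NonZero k}} → Pred (Permutation′ N) 0ℓ
𝓓⟨ p ⟩ N k = 𝓓 N k ∩ λ π → ¬ Contains p π

------------------------------------------------------------------------
-- Finite posets and linear extensions

record FinPoset (N : ℕ) : Set₁ where
  infix 4 _≺_
  field
    _≺_                  : Rel (Fin N) 0ℓ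
    isStrictPartialOrder : IsStrictPartialOrder _≡_ _≺_

LinearExtension : ∀ {N} → FinPoset N → Pred (Permutation′ N) 0ℓ
LinearExtension P σ = ∀ {x y} → x ≺ y → σ ⟨$⟩ʳ x Fin.< σ ⟨$⟩ʳ y
  where open FinPoset P

infix 4 LE[_]≡_
LE[_]≡_ : ∀ {N} → FinPoset N → ℕ → Set
LE[ P ]≡ n = ∣ LinearExtension P ∣≡ n

-- A strictly monotone rank certifies that a relation generates a poset.
Ranked : ∀ {N} → Rel (Fin N) 0ℓ → (Fin N → ℕ) → Set
Ranked R rank = ∀ {x y} → R x y → rank x < rank y

closure-ranked : ∀ {N} {R : Rel (Fin N) 0ℓ} {rank} → Ranked R rank → Ranked (TransClosure R) rank
closure-ranked r [ xRy ]      = r xRy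
closure-ranked r (xRy ∷ yR⁺z) = <-trans (r xRy) (closure-ranked r yR⁺z)

generated : ∀ {N} (R : Rel (Fin N) 0ℓ) {rank} → Ranked R rank → FinPoset N
generated R r = record
  { _≺_                  = TransClosure R
  ; isStrictPartialOrder = record
    { isEquivalence = isEquivalence
    ; irrefl        = λ { refl xR⁺x → <-irrefl refl (closure-ranked r xR⁺x) }
    ; trans         = transitive R
    ; <-resp-≈      = resp₂ (TransClosure R)
    }
  }

addRelations : ∀ {N} (P : FinPoset N) (R : Rel (Fin N) 0ℓ) {rank} →
               Ranked (FinPoset._≺_ P ∪ R) rank → FinPoset N
addRelations P R = generated (FinPoset._≺_ P ∪ R)

------------------------------------------------------------------------
-- The block posets

module Blocks (m s k : ℕ) where

  N : ℕ
  N = m * k + s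

  -- `X i a p` says that p is the position x_{i,a}.
  X : ℕ → ℕ → Fin N → Set
  X i a p = ((1 ≤ i × i ≤ m × 1 ≤ a × a ≤ k) ⊎ (i ≡ suc m × 1 ≤ a × a ≤ s))
          × pos p ≡ (i ∸ 1) * k + a

  data BlockRel : Rel (Fin N) 0ℓ where
    inside : ∀ {i a p q} → X i a p → X i (suc a) q → BlockRel p q
    across : ∀ {i p q} → 1 ≤ i → i ≤ m → X (suc i) 1 p → X i k q → BlockRel p q

  data AscentRel : Rel (Fin N) 0ℓ where
    ascent : ∀ {i a p q y} → X i a p → X i (suc a) q → y Fin.< p → AscentRel p y

  data DescentRel : Rel (Fin N) 0ℓ where
    descent : ∀ {i p q y} → 1 ≤ i → i ≤ m → X i k p → X (suc i) 1 q → y Fin.< p → DescentRel y p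

  module _ .{{_ : NonZero k}} (2≤k : 2 ≤ k) (s≤k : s ≤ k) where

    private
      col : Fin N → ℕ
      col p = toℕ p % k

      a-bounds : ∀ {i a p} → X i a p → 1 ≤ a × a ≤ k
      a-bounds (inj₁ (_ , _ , 1≤a , a≤k) , _) = 1≤a , a≤k
      a-bounds (inj₂ (_ , 1≤a , a≤s) , _)     = 1≤a , ≤-trans a≤s s≤k

      col-X : ∀ {i a p} → X i a p → suc (col p) ≡ a
      col-X {i} {zero} x = contradiction (proj₁ (a-bounds x)) λ ()
      col-X {i} {suc a} {p} x = cong suc (begin
        toℕ p % k              ≡⟨ cong (_% k) (suc-injective (trans (proj₂ x) (+-suc ((i ∸ 1) * k) a))) ⟩
        ((i ∸ 1) * k + a) % k  ≡⟨ cong (_% k) (+-comm ((i ∸ 1) * k) a) ⟩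
        (a + (i ∸ 1) * k) % k  ≡⟨ [m+kn]%n≡m%n a (i ∸ 1) k ⟩
        a % k                  ≡⟨ m<n⇒m%n≡m (proj₂ (a-bounds x)) ⟩
        a                      ∎)
        where open ≡-Reasoning

      a≤pos : ∀ {i a p} → X i a p → a ≤ pos p
      a≤pos {i} {a} x = subst (a ≤_) (sym (proj₂ x)) (m≤n+m a ((i ∸ 1) * k))

      next : ∀ {i a p q} → X i a p → X i (suc a) q → toℕ q ≡ suc (toℕ p)
      next {i} {a} x x⁺ = suc-injective (trans (proj₂ x⁺)
        (trans (+-suc ((i ∸ 1) * k) a) (cong suc (sym (proj₂ x)))))

      lower : Fin N → ℕ
      lower p with suc (col p) ≟ k
      ... | yes _ = N + toℕ p
      ... | no  _ = toℕ p

      toℕ≤lower : ∀ p → toℕ p ≤ lower p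
      toℕ≤lower p with suc (col p) ≟ k
      ... | yes _ = m≤n+m (toℕ p) N
      ... | no  _ = ≤-refl

      lower≤ : ∀ p → lower p ≤ N + toℕ p
      lower≤ p with suc (col p) ≟ k
      ... | yes _ = ≤-refl
      ... | no  _ = m≤n+m (toℕ p) N

      lower-end : ∀ p → suc (col p) ≡ k → lower p ≡ N + toℕ p
      lower-end p e with suc (col p) ≟ k
      ... | yes _ = refl
      ... | no ¬e = contradiction e ¬e

      lower-mid : ∀ p → suc (col p) < k → lower p ≡ toℕ p
      lower-mid p l with suc (col p) ≟ k
      ... | yes e = contradiction l (<-irrefl e)
      ... | no  _ = refl

      block-lower : Ranked BlockRel lower
      block-lower {p} {q} (inside x x⁺) = begin-strict
        lower p  ≡⟨ lower-mid p (subst (_< k) (sym (col-X x)) (proj₂ (a-bounds x⁺))) ⟩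
        toℕ p    <⟨ ≤-reflexive (sym (next x x⁺)) ⟩
        toℕ q    ≤⟨ toℕ≤lower q ⟩
        lower q  ∎
        where open ≤-Reasoning
      block-lower {p} {q} (across _ _ x y) = begin-strict
        lower p    ≡⟨ lower-mid p (subst (_< k) (sym (col-X x)) 2≤k) ⟩
        toℕ p      <⟨ toℕ<n p ⟩
        N          ≤⟨ m≤m+n N (toℕ q) ⟩
        N + toℕ q  ≡⟨ lower-end q (col-X y) ⟨
        lower q    ∎
        where open ≤-Reasoning

      descent-lower : Ranked DescentRel lower
      descent-lower {y} {p} (descent _ _ x _ y<p) = begin-strict
        lower y    ≤⟨ lower≤ y ⟩
        N + toℕ y  <⟨ +-monoʳ-< N y<p ⟩
        N + toℕ p  ≡⟨ lower-end p (col-X x) ⟨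
        lower p    ∎
        where open ≤-Reasoning

    B : FinPoset N
    B = generated BlockRel block-lower

    P³²¹′ : FinPoset N
    P³²¹′ = addRelations B DescentRel λ where
      (inj₁ b) → closure-ranked block-lower b
      (inj₂ d) → descent-lower d

    -- When k ≥ 3 and N ≥ 3 the added relations create cycles.
    module _ (small : ¬ (3 ≤ k × 3 ≤ N)) where

      private
        upper : Fin N → ℕ
        upper p with col p
        ... | zero  = N ∸ toℕ p
        ... | suc _ = N + toℕ p

        upper-start : ∀ p → col p ≡ 0 → upper p ≡ N ∸ toℕ p
        upper-start p e with zero ← col p = refl

        upper-later : ∀ p → 0 < col p → upper p ≡ N + toℕ p
        upper-later p l with suc _ ← col p = refl

        N∸≤upper : ∀ p → N ∸ toℕ p ≤ upper p
        N∸≤upper p with col p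
        ... | zero  = ≤-refl
        ... | suc _ = ≤-trans (m∸n≤m N (toℕ p)) (m≤m+n N (toℕ p))

        first : ∀ {i a p q} → X i a p → X i (suc a) q → a ≡ 1
        first {a = zero}        x _  = contradiction (proj₁ (a-bounds x)) λ ()
        first {a = suc zero}    _ _  = refl
        first {a = suc (suc a)} {q = q} _ x⁺ = contradiction
          ( ≤-trans 3≤ (proj₂ (a-bounds x⁺))
          , ≤-trans 3≤ (≤-trans (a≤pos x⁺) (toℕ<n q)) ) small
          where
          3≤ : 3 ≤ suc (suc (suc a))
          3≤ = s≤s (s≤s (s≤s z≤n))

        start<later : ∀ p q {b} → col p ≡ 0 → 2 ≤ b → suc (col q) ≡ b → b ≤ pos q → upper p < upper q
        start<later p q cp 2≤b cq b≤ = begin-strict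
          upper p    ≡⟨ upper-start p cp ⟩
          N ∸ toℕ p  ≤⟨ m∸n≤m N (toℕ p) ⟩
          N          <⟨ m<m+n N (s≤s⁻¹ (≤-trans 2≤b b≤)) ⟩
          N + toℕ q  ≡⟨ upper-later q (s≤s⁻¹ (≤-trans 2≤b (≤-reflexive (sym cq)))) ⟨
          upper q    ∎
          where open ≤-Reasoning

        block-upper : Ranked BlockRel upper
        block-upper {p} {q} (inside x x⁺) with refl ← first x x⁺ =
          start<later p q (suc-injective (col-X x)) ≤-refl (col-X x⁺) (a≤pos x⁺)
        block-upper {p} {q} (across _ _ x y) =
          start<later p q (suc-injective (col-X x)) 2≤k (col-X y) (a≤pos y)

        ascent-upper : Ranked AscentRel upper
        ascent-upper {p} {y} (ascent x x⁺ y<p) = begin-strict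
          upper p    ≡⟨ upper-start p (suc-injective (trans (col-X x) (first x x⁺))) ⟩
          N ∸ toℕ p  <⟨ ∸-monoʳ-< y<p (<⇒≤ (toℕ<n p)) ⟩
          N ∸ toℕ y  ≤⟨ N∸≤upper y ⟩
          upper y    ∎
          where open ≤-Reasoning

      P¹²³ : FinPoset N
      P¹²³ = addRelations B AscentRel λ where
        (inj₁ b) → closure-ranked block-upper b
        (inj₂ a) → ascent-upper a

------------------------------------------------------------------------
-- Products

∏[1≤j≤_]_ : ℕ → (ℕ → ℕ) → ℕ
∏[1≤j≤ m ] f = product (applyUpTo (λ j → f (suc j)) m)

{-# OPTIONS --safe #-}

-- A permutation is built by appending its last letter, which relabels the old values
-- order-preservingly.  Whether a value v may be appended to an admissible permutation
-- depends only on v, on the last value r and on whether the new step is a descent: in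
-- each of the six cases the descents or the ascents are free (v ≤ r, resp. r < v), and
-- the others are restricted by the pattern, e.g. to v = 0 for 1-32 and to v = r + 1 for 2-13.
-- So 𝓓⟨p⟩ is counted by walks on the last value.  For 1-32, 2-13 and 3-12 the number of
-- completions of a walk is propagated from the end to the start; for 2-31 the number of
-- walks ending in r is propagated from the start.  For 2-13 and 2-31 these numbers are
-- Raney numbers, the coefficients of the powers of the series 𝔅 = 1 + z 𝔅ᵏ.
-- For 1-23 and 3-21 the condition on a step is the order relation added to the poset.

module Submission where

open import Defs
import Algebra.Properties.Semiring.Sum
open import Data.Bool.Base using (if_then_else_; true; false)
open import Data.Fin.Base as Fin using (Fin; zero; suc; toℕ; fromℕ; fromℕ<; inject₁; join; punchIn; splitAt)
open import Data.Fin.Patterns using (0F; 1F; 2F)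
open import Data.Fin.Permutation as Perm using (Permutation′; _⟨$⟩ʳ_; _⟨$⟩ˡ_; _≈_)
open import Data.Fin.Properties as Fin
  using (all?; join-splitAt; punchIn-cancel-≤; punchIn-mono-≤; splitAt-join; toℕ-fromℕ; toℕ-fromℕ<; toℕ-inject₁; toℕ<n; toℕ≤pred[n])
open import Data.Fin.Relation.Unary.Top using (view; ‵fromℕ; ‵inject₁)
open import Data.Nat.Base
open import Data.Nat.Combinatorics using (_C_; nC1≡n; nCk+nC[k+1]≡[n+1]C[k+1]; nCn≡1)
open import Data.Nat.Divisibility
open import Data.Nat.DivMod using (_/_; _%_; /-monoˡ-≤; m%n<n; m*n/n≡m; m/n*n≤m; m≡m%n+[m/n]*n)
open import Data.Nat.Properties
open import Data.Nat.Tactic.RingSolver using (solve-∀)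
open import Data.Product.Base using (∃-syntax; _×_; _,_; proj₁; proj₂)
open import Data.Sum.Base using (_⊎_; inj₁; inj₂; [_,_]′)
open import Data.Vec.Base using (Vec; []; _∷_; lookup; map)
open import Data.Vec.Properties using (lookup-map)
open import Function.Base using (_∘_; id)
open import Function.Bundles using (_⇔_; mk⇔; Equivalence)
open import Function.Construct.Symmetry using (⇔-sym)
open import Level using (0ℓ)
open import Relation.Binary.Construct.Closure.Transitive using (TransClosure; [_])
import Relation.Binary.Construct.Union as Rel₂
open import Relation.Binary.Core using (Rel)
open import Relation.Binary.Definitions using (tri<; tri≈; tri>)
open import Relation.Binary.PropositionalEquality
open import Relation.Nullary.Decidable using (Dec; yes; no; does; map′; _×-dec_; _→-dec_; ¬?)
open import Relation.Nullary.Negation using (¬_; contradiction)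
open import Relation.Unary using (Pred; _≐_; _∪_)

open Algebra.Properties.Semiring.Sum +-*-semiring
  using (sum; sum-syntax; sum⁺-syntax; sum-cong-≗; sum-replicate-zero; ∑-comm; *-distribˡ-sum; *-distribʳ-sum)
open Equivalence using (to; from)

private
  variable
    l m n o : ℕ

-- Enumerations of sets of permutations

-- A list without repetition up to `≈` combines over unions and images more directly than an
-- `Inverse` of setoids; `cardinality` converts at the end.
record Enumeration {o} (S : Pred (Permutation′ o) 0ℓ) (n : ℕ) : Set where
  field
    enum      : Fin n → Permutation′ o
    sound     : ∀ i → S (enum i)
    injective : ∀ {i j} → enum i ≈ enum j → i ≡ j
    complete  : ∀ {π} → S π → ∃[ i ] enum i ≈ π

  cardinality : ∣ S ∣≡ n
  cardinality = record
    { to        = λ (_ , s) → proj₁ (complete s)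
    ; from      = λ i → enum i , sound i
    ; to-cong   = λ {x} {y} π≈σ → injective λ i → trans (proj₂ (complete (proj₂ x)) i)
                    (trans (π≈σ i) (sym (proj₂ (complete (proj₂ y)) i)))
    ; from-cong = λ { refl _ → refl }
    ; inverse   = (λ {_} {y} y≈ → injective λ i → trans (proj₂ (complete (proj₂ y)) i) (y≈ i))
                , (λ { {x} refl → proj₂ (complete (proj₂ x)) })
    }

private
  variable
    S T : Pred (Permutation′ o) 0ℓ

enum-≐ : S ≐ T → Enumeration S n → Enumeration T n
enum-≐ (S⊆T , T⊆S) e = record
  { enum      = enum
  ; sound     = λ i → S⊆T (sound i)
  ; injective = injective
  ; complete  = λ t → complete (T⊆S t)
  }
  where open Enumeration e

enum-∅ : (∀ {π} → ¬ S π) → Enumeration S 0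
enum-∅ ¬S = record
  { enum      = λ ()
  ; sound     = λ ()
  ; injective = λ { {()} }
  ; complete  = λ s → contradiction s ¬S
  }

enum-∪ : (∀ {π σ} → S π → T σ → ¬ π ≈ σ) → Enumeration S m → Enumeration T n →
         Enumeration (S ∪ T) (m + n)
enum-∪ {S = S} {T = T} {m = m} {n = n} disjoint e f = record
  { enum      = pick ∘ splitAt m
  ; sound     = sound ∘ splitAt m
  ; injective = λ {i} {j} eq → trans (sym (join-splitAt m n i))
                  (trans (cong (join m n) (injective (splitAt m i) (splitAt m j) eq)) (join-splitAt m n j))
  ; complete  = complete
  }
  where
  module E = Enumeration e
  module F = Enumeration f

  pick : Fin m ⊎ Fin n → Permutation′ _
  pick = [ E.enum , F.enum ]′

  sound : ∀ i → (S ∪ T) (pick i)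
  sound (inj₁ i) = inj₁ (E.sound i)
  sound (inj₂ j) = inj₂ (F.sound j)

  injective : ∀ i j → pick i ≈ pick j → i ≡ j
  injective (inj₁ i) (inj₁ j) eq = cong inj₁ (E.injective eq)
  injective (inj₁ i) (inj₂ j) eq = contradiction eq (disjoint (E.sound i) (F.sound j))
  injective (inj₂ i) (inj₁ j) eq = contradiction (sym ∘ eq) (disjoint (E.sound j) (F.sound i))
  injective (inj₂ i) (inj₂ j) eq = cong inj₂ (F.injective eq)

  complete : ∀ {π} → (S ∪ T) π → ∃[ i ] pick (splitAt m i) ≈ π
  complete (inj₁ s) with i , eq ← E.complete s =
    join m n (inj₁ i) , λ x → trans (cong (λ a → pick a ⟨$⟩ʳ x) (splitAt-join m n (inj₁ i))) (eq x)
  complete (inj₂ t) with j , eq ← F.complete t =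
    join m n (inj₂ j) , λ x → trans (cong (λ a → pick a ⟨$⟩ʳ x) (splitAt-join m n (inj₂ j))) (eq x)

enum-⋃ : ∀ {o n} {S : Fin n → Pred (Permutation′ o) 0ℓ} {c : Fin n → ℕ} →
         (∀ {i j π σ} → S i π → S j σ → π ≈ σ → i ≡ j) →
         (∀ i → Enumeration (S i) (c i)) → Enumeration (λ π → ∃[ i ] S i π) (sum c)
enum-⋃ {n = zero}          disjoint e = enum-∅ λ ()
enum-⋃ {n = suc n} {S = S} disjoint e = enum-≐
  ( (λ { (inj₁ s) → zero , s ; (inj₂ (i , s)) → suc i , s })
  , (λ { (zero , s) → inj₁ s ; (suc i , s) → inj₂ (i , s) }) )
  (enum-∪ (λ s (_ , t) eq → contradiction (disjoint s t eq) λ ())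
    (e zero)
    (enum-⋃ (λ s t eq → Fin.suc-injective (disjoint s t eq)) (e ∘ suc)))

Image : (Permutation′ l → Permutation′ o) → Pred (Permutation′ l) 0ℓ → Pred (Permutation′ o) 0ℓ
Image φ S ρ = ∃[ π ] S π × φ π ≈ ρ

enum-image : (φ : Permutation′ l → Permutation′ o) → (∀ {π σ} → π ≈ σ → φ π ≈ φ σ) →
             (∀ {π σ} → φ π ≈ φ σ → π ≈ σ) → Enumeration S n → Enumeration (Image φ S) n
enum-image φ φ-cong φ-inj e = record
  { enum      = φ ∘ enum
  ; sound     = λ i → enum i , sound i , λ _ → refl
  ; injective = λ eq → injective (φ-inj eq)
  ; complete  = λ (π , s , eq) → let i , eq′ = complete s in
                  i , λ x → trans (φ-cong eq′ x) (eq x)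
  }
  where open Enumeration e

-- Appending a last letter

OrderIso : {A : Set} → (A → ℕ) → (A → ℕ) → Set
OrderIso f g = ∀ x y → f x < f y ⇔ g x < g y

-- `SameOrder` only compares letters, so a relabelling that preserves and reflects `<` keeps the
-- occurrences of `p`.
sameOrder-cong : ∀ {A : Set} {f g : A → ℕ} → OrderIso f g → ∀ (p : Vec ℕ n) xs →
                 SameOrder p (map f xs) → SameOrder p (map g xs)
sameOrder-cong {f = f} {g} iso p xs same a b = mk⇔
  (λ l → subst₂ _<_ (sym (lookup-map a g xs)) (sym (lookup-map b g xs))
    (to (iso _ _) (subst₂ _<_ (lookup-map a f xs) (lookup-map b f xs) (to (same a b) l))))
  (λ l → from (same a b) (subst₂ _<_ (sym (lookup-map a f xs)) (sym (lookup-map b f xs))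
    (from (iso _ _) (subst₂ _<_ (lookup-map a g xs) (lookup-map b g xs) l))))

sameOrder? : (v w : Vec ℕ n) → Dec (SameOrder v w)
sameOrder? v w = all? λ a → all? λ b →
  map′ (λ (f , g) → mk⇔ f g) (λ e → to e , from e)
    ((lookup v a <? lookup v b →-dec lookup w a <? lookup w b)
     ×-dec (lookup w a <? lookup w b →-dec lookup v a <? lookup v b))

toℕ-punchIn-iso : (v : Fin (suc n)) → OrderIso (toℕ {n}) (toℕ ∘ punchIn v)
toℕ-punchIn-iso v x y = mk⇔
  (λ x<y → ≰⇒> (<⇒≱ x<y ∘ punchIn-cancel-≤ v y x))
  (λ x<y → ≰⇒> (<⇒≱ x<y ∘ punchIn-mono-≤ v y x))

toℕ-punchIn-< : ∀ {n} (v : Fin (suc n)) x → toℕ x < toℕ v → toℕ (punchIn v x) ≡ toℕ x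
toℕ-punchIn-< (suc v) zero    _         = refl
toℕ-punchIn-< (suc v) (suc x) (s≤s x<v) = cong suc (toℕ-punchIn-< v x x<v)

toℕ-punchIn-≥ : ∀ {n} (v : Fin (suc n)) x → toℕ v ≤ toℕ x → toℕ (punchIn v x) ≡ suc (toℕ x)
toℕ-punchIn-≥ zero    x       _         = refl
toℕ-punchIn-≥ (suc v) (suc x) (s≤s v≤x) = cong suc (toℕ-punchIn-≥ v x v≤x)

word : Permutation′ o → Fin o → ℕ
word π i = toℕ (π ⟨$⟩ʳ i)

word-injective : (π : Permutation′ o) → ∀ {i j} → word π i ≡ word π j → i ≡ j
word-injective π eq = trans (sym (Perm.inverseˡ π)) (trans (cong (π ⟨$⟩ˡ_) (Fin.toℕ-injective eq)) (Perm.inverseˡ π))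

punchIn-fromℕ : ∀ {n} (i : Fin n) → punchIn (fromℕ n) i ≡ inject₁ i
punchIn-fromℕ zero    = refl
punchIn-fromℕ (suc i) = cong suc (punchIn-fromℕ i)

append : Fin (suc n) → Permutation′ n → Permutation′ (suc n)
append = Perm.insert (fromℕ _)

append-inject₁ : ∀ (v : Fin (suc n)) π i → append v π ⟨$⟩ʳ inject₁ i ≡ punchIn v (π ⟨$⟩ʳ i)
append-inject₁ v π i = trans (cong (append v π ⟨$⟩ʳ_) (sym (punchIn-fromℕ i))) (Perm.insert-punchIn (fromℕ _) v π i)

append-fromℕ : ∀ (v : Fin (suc n)) π → append v π ⟨$⟩ʳ fromℕ n ≡ v
append-fromℕ {n} v π with fromℕ n Fin.≟ fromℕ n
... | yes _ = refl
... | no ≢  = contradiction refl ≢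

append-cong : ∀ (v : Fin (suc n)) {π σ} → π ≈ σ → append v π ≈ append v σ
append-cong v {π} {σ} π≈σ i with view i
... | ‵fromℕ     = trans (append-fromℕ v π) (sym (append-fromℕ v σ))
... | ‵inject₁ j = trans (append-inject₁ v π j)
                     (trans (cong (punchIn v) (π≈σ j)) (sym (append-inject₁ v σ j)))

append-injective : ∀ (v : Fin (suc n)) {π σ} → append v π ≈ append v σ → π ≈ σ
append-injective v {π} {σ} eq i = Fin.punchIn-injective v _ _
  (trans (sym (append-inject₁ v π i)) (trans (eq (inject₁ i)) (append-inject₁ v σ i)))

-- Permutations built letter by letter, and weighted counts of them

module Codes (p : Vec ℕ 3) (k : ℕ) where

  -- In use, `i` is the zero-based position of the right letter y, hence the one-based position of
  -- x, so `k ∣ i` marks the prescribed descents.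
  Alternates : ℕ → ℕ → ℕ → Set
  Alternates i x y = (k ∣ i → y < x) × (¬ k ∣ i → x < y)

  Good : (Fin o → ℕ) → Set
  Good w = ∀ {j j⁺} → toℕ j⁺ ≡ suc (toℕ j) →
    Alternates (toℕ j⁺) (w j) (w j⁺) ×
    (∀ {i} → i Fin.< j → ¬ SameOrder p (w i ∷ w j ∷ w j⁺ ∷ []))

  alternates-resp : ∀ {i i′ x y} → i ≡ i′ → Alternates i x y → Alternates i′ x y
  alternates-resp refl alt = alt

  good-cong : ∀ {f g : Fin o → ℕ} → OrderIso f g → Good f → Good g
  good-cong {f = f} {g} iso good {j} {j⁺} next with (d , a) , av ← good next =
    ((λ k∣ → to (iso _ _) (d k∣)) , (λ ∤k → to (iso _ _) (a ∤k))) ,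
    λ {i} i<j same → av i<j (sameOrder-cong (λ x y → ⇔-sym (iso x y)) p (i ∷ j ∷ j⁺ ∷ []) same)

  alternates? : ∀ i x y → Dec (Alternates i x y)
  alternates? i x y = (k ∣? i →-dec y <? x) ×-dec (¬? (k ∣? i) →-dec x <? y)

  -- v may be appended to a good permutation with last value r: punchIn v relabels the
  -- old values, and y runs through those left of the last position.
  Step : ∀ {n} → Fin n → Fin (suc n) → Set
  Step {n} r v = Alternates n (toℕ (punchIn v r)) (toℕ v) ×
    (∀ y → y ≢ r → ¬ SameOrder p (toℕ (punchIn v y) ∷ toℕ (punchIn v r) ∷ toℕ v ∷ []))

  step? : ∀ {n} (r : Fin n) v → Dec (Step r v)
  step? {n} r v = alternates? n _ _ ×-dec all? λ y → ¬? (y Fin.≟ r) →-dec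
    ¬? (sameOrder? p (toℕ (punchIn v y) ∷ toℕ (punchIn v r) ∷ toℕ v ∷ []))

  -- `ρ` is given by its initial part and its last letter rather than as `append v π`, since
  -- permutations are identified only up to `≈`.
  module _ {n} (ρ : Permutation′ (suc (suc n))) (π : Permutation′ (suc n)) (v : Fin (suc (suc n)))
           (ρ-init : ∀ i → ρ ⟨$⟩ʳ inject₁ i ≡ punchIn v (π ⟨$⟩ʳ i))
           (ρ-last : ρ ⟨$⟩ʳ fromℕ (suc n) ≡ v) where

    private
      init≡ : ∀ i → word ρ (inject₁ i) ≡ toℕ (punchIn v (π ⟨$⟩ʳ i))
      init≡ i = cong toℕ (ρ-init i)

      last≡ : word ρ (fromℕ (suc n)) ≡ toℕ v
      last≡ = cong toℕ ρ-last

      iso : OrderIso (word π) (word ρ ∘ inject₁)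
      iso x y rewrite init≡ x | init≡ y = toℕ-punchIn-iso v _ _

      fromℕ-next : toℕ (fromℕ (suc n)) ≡ suc (toℕ (inject₁ (fromℕ n)))
      fromℕ-next = cong suc (sym (toℕ-inject₁ (fromℕ n)))

      top : toℕ (fromℕ (suc n)) ≡ suc n
      top = toℕ-fromℕ (suc n)

    good-init : Good (word ρ) → Good (word π)
    good-init good = good-cong (λ x y → ⇔-sym (iso x y)) init-good
      where
      init-good : Good (word ρ ∘ inject₁)
      init-good {j} {j⁺} next with (d , a) , av ← good {inject₁ j} {inject₁ j⁺}
        (trans (toℕ-inject₁ j⁺) (trans next (cong suc (sym (toℕ-inject₁ j))))) =
        alternates-resp (toℕ-inject₁ j⁺) (d , a) ,
        λ {i} i<j → av (subst₂ _<_ (sym (toℕ-inject₁ i)) (sym (toℕ-inject₁ j)) i<j)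

    good-last : Good (word ρ) → Step (π ⟨$⟩ʳ fromℕ n) v
    good-last good with alt , av ← good fromℕ-next =
      subst₂ (Alternates (suc n)) (init≡ _) last≡ (alternates-resp top alt) ,
      -- An old value y other than the last one sits at `π ⟨$⟩ˡ y`, strictly left of the final
      -- adjacent pair, so a triple forbidden by `Step` would be an occurrence in `ρ`.
      λ y y≢ same → av {inject₁ (π ⟨$⟩ˡ y)} (below y y≢)
        (subst (SameOrder p) (cong₂ _∷_ (sym (trans (init≡ _) (cong (toℕ ∘ punchIn v) (Perm.inverseʳ π))))
          (cong₂ (λ a b → a ∷ b ∷ []) (sym (init≡ _)) (sym last≡))) same)
      where
      below : ∀ y → y ≢ π ⟨$⟩ʳ fromℕ n → toℕ (inject₁ (π ⟨$⟩ˡ y)) < toℕ (inject₁ (fromℕ n))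
      below y y≢ = ≤∧≢⇒< (subst₂ _≤_ (sym (toℕ-inject₁ _)) (sym (toℕ-inject₁ _)) (Fin.≤fromℕ _))
        λ eq → y≢ (trans (sym (Perm.inverseʳ π)) (cong (π ⟨$⟩ʳ_)
          (Fin.inject₁-injective (Fin.toℕ-injective eq))))

    -- The only new adjacent pair is the one ending in the appended letter, and `Step` governs it.
    -- Every other pair lies in the initial part, where `iso` transports the condition from `π`.
    good-snoc : Good (word π) → Step (π ⟨$⟩ʳ fromℕ n) v → Good (word ρ)
    good-snoc good step {j} {j⁺} next with view j⁺ | view j
    ... | ‵fromℕ | ‵fromℕ = contradiction next (<⇒≢ (n<1+n _))
    ... | ‵fromℕ | ‵inject₁ j′
      with refl ← Fin.toℕ-injective {i = j′} {fromℕ n}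
        (trans (sym (toℕ-inject₁ j′)) (suc-injective (sym next))) =
      alternates-resp (sym top)
        (subst₂ (Alternates (suc n)) (sym (init≡ _)) (sym last≡) (proj₁ step)) ,
      avoid
      where
      avoid : ∀ {i} → i Fin.< inject₁ (fromℕ n) →
              ¬ SameOrder p (word ρ i ∷ word ρ (inject₁ (fromℕ n)) ∷ word ρ (fromℕ (suc n)) ∷ [])
      avoid {i} i<j same with view i
      ... | ‵fromℕ = <⇒≱ i<j (m≤n⇒m≤1+n (≤-reflexive (toℕ-inject₁ (fromℕ n))))
      ... | ‵inject₁ i′ = proj₂ step (π ⟨$⟩ʳ i′)
        (λ eq → <-irrefl (cong (toℕ ∘ inject₁) (word-injective π (cong toℕ eq))) i<j)
        (subst (SameOrder p) (cong₂ _∷_ (init≡ i′) (cong₂ (λ a b → a ∷ b ∷ []) (init≡ _) last≡)) same)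
    good-snoc good step {j} {j⁺} next | ‵inject₁ j⁺′ | ‵fromℕ =
      contradiction next (<⇒≢ (<-trans (subst₂ _<_ (sym (toℕ-inject₁ j⁺′)) (sym top) (toℕ<n j⁺′)) (n<1+n _)))
    good-snoc good step {j} {j⁺} next | ‵inject₁ j⁺′ | ‵inject₁ j′
      with (alt , av) ← good-cong iso good {j′} {j⁺′}
        (trans (sym (toℕ-inject₁ j⁺′)) (trans next (cong suc (toℕ-inject₁ j′)))) =
      alternates-resp (sym (toℕ-inject₁ j⁺′)) alt , avoid
      where
      avoid : ∀ {i} → i Fin.< inject₁ j′ →
              ¬ SameOrder p (word ρ i ∷ word ρ (inject₁ j′) ∷ word ρ (inject₁ j⁺′) ∷ [])
      avoid {i} i<j same with view i
      ... | ‵fromℕ = <-asym i<j (subst₂ _<_ (sym (toℕ-inject₁ j′)) (sym top) (toℕ<n j′))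
      ... | ‵inject₁ i′ = av (subst₂ _<_ (toℕ-inject₁ i′) (toℕ-inject₁ j′) i<j) same

  GoodEnding : Fin (suc n) → Pred (Permutation′ (suc n)) 0ℓ
  GoodEnding {n} v π = Good (word π) × π ⟨$⟩ʳ fromℕ n ≡ v

  -- The index n stands for permutations of size n + 1.
  count : ∀ n → Fin (suc n) → ℕ
  count zero    v = 1
  count (suc n) v = ∑[ r ≤ n ] (if does (step? r v) then count n r else 0)

  Appended : Fin (suc n) → Fin (suc (suc n)) → Pred (Permutation′ (suc (suc n))) 0ℓ
  Appended r v ρ = Step r v × Image (append v) (GoodEnding r) ρ

  -- Removing the last letter inverts `append v`, so the good permutations ending in v split
  -- according to the last value r of what remains, over those r that admit the step to v.
  enum-good : ∀ n (v : Fin (suc n)) → Enumeration (GoodEnding v) (count n v)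
  enum-good zero zero = record
    { enum      = λ _ → Perm.id
    ; sound     = λ _ → (λ { {zero} {zero} () }) , refl
    ; injective = λ { {zero} {zero} _ → refl }
    ; complete  = λ {π} (_ , eq) → zero , λ { zero → sym eq }
    }
  enum-good (suc n) v = enum-≐ ((λ {ρ} → ⊆ {ρ}) , (λ {ρ} → ⊇ {ρ})) (enum-⋃ (λ {r} {s} {π} {σ} → disjoint {r} {s} {π} {σ}) pieces)
    where
    disjoint : ∀ {r s π σ} → Appended r v π → Appended s v σ → π ≈ σ → r ≡ s
    disjoint (_ , π , (_ , refl) , eq) (_ , σ , (_ , refl) , eq′) eq″ =
      append-injective v {π} {σ} (λ i → trans (eq i) (trans (eq″ i) (sym (eq′ i)))) (fromℕ n)

    -- The decision is an argument so that matching on it reduces `does d` in the type.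
    piece : ∀ r (d : Dec (Step r v)) → Enumeration (Appended r v) (if does d then count n r else 0)
    piece r (yes step) = enum-≐ ((step ,_) , proj₂)
      (enum-image (append v) (λ {π} {σ} → append-cong v {π} {σ})
        (λ {π} {σ} → append-injective v {π} {σ}) (enum-good n r))
    piece r (no ¬step) = enum-∅ λ (step , _) → ¬step step

    pieces : ∀ r → Enumeration (Appended r v) (if does (step? r v) then count n r else 0)
    pieces r = piece r (step? r v)

    init≡ : ∀ {π ρ} → append v π ≈ ρ → ∀ i → ρ ⟨$⟩ʳ inject₁ i ≡ punchIn v (π ⟨$⟩ʳ i)
    init≡ {π} eq i = trans (sym (eq (inject₁ i))) (append-inject₁ v π i)

    last≡ : ∀ {π ρ} → append v π ≈ ρ → ρ ⟨$⟩ʳ fromℕ (suc n) ≡ v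
    last≡ {π} eq = trans (sym (eq _)) (append-fromℕ v π)

    ⊆ : ∀ {ρ} → ∃[ r ] Appended r v ρ → GoodEnding v ρ
    ⊆ {ρ} (r , step , π , (good , refl) , eq) =
      good-snoc ρ π v (init≡ {π} {ρ} eq) (last≡ {π} {ρ} eq) good step , last≡ {π} {ρ} eq

    ⊇ : ∀ {ρ} → GoodEnding v ρ → ∃[ r ] Appended r v ρ
    ⊇ {ρ} (good , refl) = π ⟨$⟩ʳ fromℕ n ,
      good-last ρ π v (init≡ {π} {ρ} eq) refl good ,
      π , (good-init ρ π v (init≡ {π} {ρ} eq) refl good , refl) , eq
      where
      π = Perm.remove (fromℕ (suc n)) ρ
      eq : append v π ≈ ρ
      eq = Perm.insert-remove (fromℕ (suc n)) ρ

  enum-total : ∀ n → Enumeration {suc n} (λ π → Good (word π)) (∑[ v ≤ n ] count n v)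
  enum-total n = enum-≐ ((λ {π} → ⊆ {π}) , (λ {π} → ⊇ {π}))
    (enum-⋃ (λ {r} {s} {π} {σ} → disjoint {r} {s} {π} {σ}) (enum-good n))
    where
    disjoint : ∀ {v v′ π σ} → GoodEnding {n} v π → GoodEnding v′ σ → π ≈ σ → v ≡ v′
    disjoint (_ , eq) (_ , eq′) π≈σ = trans (sym eq) (trans (π≈σ (fromℕ n)) eq′)

    ⊆ : ∀ {π} → ∃[ v ] GoodEnding {n} v π → Good (word π)
    ⊆ (_ , good , _) = good

    ⊇ : ∀ {π} → Good (word π) → ∃[ v ] GoodEnding {n} v π
    ⊇ {π} good = π ⟨$⟩ʳ fromℕ n , good , refl

  -- A functional of the distribution of last values: `f r` is a weight such as the number of
  -- completions from r, and the constant weight 1 gives the number of good permutations of size n +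
  -- 1.
  E : ∀ n → (ℕ → ℕ) → ℕ
  E n f = ∑[ r ≤ n ] (count n r * f (toℕ r))

  E-cong : ∀ n (f g : ℕ → ℕ) → (∀ r → r ≤ n → f r ≡ g r) → E n f ≡ E n g
  E-cong n f g f≡g = sum-cong-≗ λ r → cong (count n r *_) (f≡g (toℕ r) (Fin.toℕ≤pred[n] r))

  E-* : ∀ n c f → E n (λ r → c * f r) ≡ c * E n f
  E-* n c f = trans (sum-cong-≗ λ r → *-comm-middle (count n r) (f (toℕ r)))
    (sym (*-distribˡ-sum {suc n} c (λ r → count n r * f (toℕ r))))
    where
    *-comm-middle : ∀ a b → a * (c * b) ≡ c * (a * b)
    *-comm-middle a b = trans (sym (*-assoc a c b)) (trans (cong (_* b) (*-comm a c)) (*-assoc c a b))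

  -- Exchanging the two sums moves one step of the walk from `count` to the weight: `g r` collects
  -- `f v` over the values v that may follow r.
  E-suc : ∀ n (f g : ℕ → ℕ) →
          (∀ r → ∑[ v ≤ suc n ] (if does (step? r v) then f (toℕ v) else 0) ≡ g (toℕ r)) →
          E (suc n) f ≡ E n g
  E-suc n f g step = begin
    E (suc n) f
      ≡⟨ sum-cong-≗ (λ v → trans (*-distribʳ-sum (f (toℕ v)) (λ r → if does (step? r v) then count n r else 0))
                                 (sum-cong-≗ (λ r → swap-if (does (step? r v)) (count n r) (f (toℕ v))))) ⟩
    ∑[ v ≤ suc n ] ∑[ r ≤ n ] (count n r * (if does (step? r v) then f (toℕ v) else 0))
      ≡⟨ ∑-comm (λ v r → count n r * (if does (step? {suc n} r v) then f (toℕ v) else 0)) ⟩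
    ∑[ r ≤ n ] ∑[ v ≤ suc n ] (count n r * (if does (step? r v) then f (toℕ v) else 0))
      ≡⟨ sum-cong-≗ (λ r → trans (sym (*-distribˡ-sum (count n r) (λ v → if does (step? r v) then f (toℕ v) else 0)))
                                 (cong (count n r *_) (step r))) ⟩
    E n g ∎
    where
    open ≡-Reasoning
    swap-if : ∀ b x y → (if b then x else 0) * y ≡ x * (if b then y else 0)
    swap-if true  x y = refl
    swap-if false x y = sym (*-zeroʳ x)

sorted-iso : ∀ {x y z} → x < y → y < z → OrderIso (suc ∘ toℕ) (lookup (x ∷ y ∷ z ∷ []))
sorted-iso {x} {y} {z} x<y y<z a b = mk⇔ (mono a b ∘ s≤s⁻¹) reflect
  where
  mono : ∀ a b → a Fin.< b → lookup (x ∷ y ∷ z ∷ []) a < lookup (x ∷ y ∷ z ∷ []) b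
  mono 0F 1F _ = x<y
  mono 0F 2F _ = <-trans x<y y<z
  mono 1F 2F _ = y<z
  mono 1F 1F (s≤s ())
  mono 2F 1F (s≤s ())
  mono 2F 2F (s≤s (s≤s ()))

  reflect : lookup (x ∷ y ∷ z ∷ []) a < lookup (x ∷ y ∷ z ∷ []) b → suc (toℕ a) < suc (toℕ b)
  reflect l with Fin.<-cmp a b
  ... | tri< a<b _ _  = s≤s a<b
  ... | tri≈ _ refl _ = contradiction l (<-irrefl refl)
  ... | tri> _ _ b<a  = contradiction l (<-asym (mono b a b<a))

-- `ρ` spells the pattern with letters starting from 0. An occurrence is thus exhibited by sorting
-- its three letters and naming the pattern, as in `0F ∷ 2F ∷ 1F ∷ []` for 1-32.
sameOrder-sorted : ∀ {x y z} → x < y → y < z → (ρ : Vec (Fin 3) n) →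
                   SameOrder (map (suc ∘ toℕ) ρ) (map (lookup (x ∷ y ∷ z ∷ [])) ρ)
sameOrder-sorted x<y y<z ρ = sameOrder-cong (sorted-iso x<y y<z) (map (suc ∘ toℕ) ρ) ρ λ _ _ → mk⇔ id id

-- Prescribed descent sets as conditions on adjacent letters

module _ (p : Vec ℕ 3) (k : ℕ) .{{_ : NonZero k}} where
  open Codes p k

  -- A descent at one-based position i compares j with j⁺ where `toℕ j⁺` is i. As letters are
  -- distinct, every other step ascends; the bound on the multiples of k only says that j⁺ is still
  -- a position.
  𝓓≐good : 𝓓⟨ p ⟩ o k ≐ (λ π → Good (word π))
  𝓓≐good {o} = (λ {π} → ⊆ π) , (λ {π} → ⊇ π)
    where
    multiple : ∀ {j⁺ : Fin o} q → suc (toℕ j⁺) ≤ o → toℕ j⁺ ≡ q * k → q ≤ (o ∸ 1) / k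
    multiple q j⁺<N eq = subst (_≤ _) (m*n/n≡m q k) (/-monoˡ-≤ k (subst (_≤ o ∸ 1) eq (∸-monoˡ-≤ 1 j⁺<N)))

    ⊆ : ∀ π → 𝓓⟨ p ⟩ o k π → Good (word π)
    ⊆ π ((des⊆ , des⊇) , avoids) {j} {j⁺} next =
      (descends , ascends) , λ i<j same → avoids (_ , _ , _ , i<j , cong suc next , same)
      where
      descends : k ∣ toℕ j⁺ → word π j⁺ < word π j
      descends (divides zero eq)      = contradiction (trans (sym next) eq) λ ()
      descends (divides (suc q) eq)
        with a , b , posa , posb , lt ← des⊇ {toℕ j⁺} (suc q , s≤s z≤n , multiple {j⁺} (suc q) (toℕ<n j⁺) eq , eq)
        with refl ← Fin.toℕ-injective {i = a} {j} (suc-injective (trans posa next))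
           | refl ← Fin.toℕ-injective {i = b} {j⁺} (suc-injective posb) = lt

      ascends : ¬ k ∣ toℕ j⁺ → word π j < word π j⁺
      ascends ∤k with <-cmp (word π j) (word π j⁺)
      ... | tri< lt _ _ = lt
      ... | tri≈ _ eq _ = contradiction (trans (cong toℕ (word-injective π eq)) next) (<⇒≢ (n<1+n _))
      ... | tri> _ _ gt with q , _ , _ , eq ← des⊆ (j , j⁺ , sym next , refl , gt) = contradiction (divides q eq) ∤k

    ⊇ : ∀ π → Good (word π) → 𝓓⟨ p ⟩ o k π
    ⊇ π good = (des⊆ , des⊇) , λ (i , j , j⁺ , i<j , next , same) → proj₂ (good (suc-injective next)) i<j same
      where
      des⊆ : ∀ {i} → Des π i → ∃[ q ] 1 ≤ q × q ≤ (o ∸ 1) / k × i ≡ q * k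
      des⊆ (a , b , refl , posb , gt) with next ← suc-injective posb | k ∣? toℕ b
      ... | no ∤k = contradiction gt (<-asym (proj₂ (proj₁ (good next)) ∤k))
      ... | yes (divides zero eq) = contradiction (trans (sym next) eq) λ ()
      ... | yes (divides (suc q) eq) = suc q , s≤s z≤n , multiple {b} (suc q) (toℕ<n b) eq , trans (sym next) eq

      des⊇ : ∀ {i} → (∃[ q ] 1 ≤ q × q ≤ (o ∸ 1) / k × i ≡ q * k) → Des π i
      des⊇ (q , 1≤q , q≤ , refl) = a , b , trans (cong suc (toℕ-fromℕ< a<N)) a+1 , cong suc (toℕ-fromℕ< b<N) ,
        proj₁ (proj₁ (good next)) (divides q (toℕ-fromℕ< b<N))
        where
        qk≤ : q * k ≤ o ∸ 1
        qk≤ = ≤-trans (*-monoˡ-≤ k q≤) (m/n*n≤m (o ∸ 1) k)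
        1≤qk : 1 ≤ q * k
        1≤qk = *-mono-≤ 1≤q (>-nonZero⁻¹ k)
        b<N : q * k < o
        b<N = subst (q * k <_) (m+[n∸m]≡n {1} {o} (≤-trans 1≤qk (≤-trans qk≤ (m∸n≤m o 1)))) (s≤s qk≤)
        a+1 : suc (q * k ∸ 1) ≡ q * k
        a+1 = m+[n∸m]≡n 1≤qk
        a<N : q * k ∸ 1 < o
        a<N = ≤-trans (≤-reflexive a+1) (<⇒≤ b<N)
        a b : Fin o
        a = fromℕ< a<N
        b = fromℕ< b<N
        next : toℕ b ≡ suc (toℕ a)
        next = trans (toℕ-fromℕ< b<N) (sym (trans (cong suc (toℕ-fromℕ< a<N)) a+1))

  enum-𝓓 : ∀ n → Enumeration (𝓓⟨ p ⟩ (suc n) k) (E n (λ _ → 1))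
  enum-𝓓 n = subst (Enumeration _) (sum-cong-≗ λ r → sym (*-identityʳ (count n r)))
    (enum-≐ ((λ {π} → proj₂ 𝓓≐good {π}) , (λ {π} → proj₁ 𝓓≐good {π})) (enum-total n))

-- Sums over intervals of values

∑-zero : (h : Fin n → ℕ) → (∀ i → h i ≡ 0) → sum h ≡ 0
∑-zero {n} h h≡0 = trans (sum-cong-≗ h≡0) (sum-replicate-zero n)

∑-interval : ∀ lo w (h : Fin n → ℕ) (f : ℕ → ℕ) → lo + w ≤ n →
             (∀ i → toℕ i < lo → h i ≡ 0) →
             (∀ i → lo ≤ toℕ i → toℕ i < lo + w → h i ≡ f (toℕ i)) →
             (∀ i → lo + w ≤ toℕ i → h i ≡ 0) →
             sum h ≡ ∑[ t < w ] f (lo + toℕ t)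
∑-interval zero zero h f _ _ _ above = ∑-zero h λ i → above i z≤n
∑-interval zero (suc w) h f (s≤s w≤n) _ inside above = cong₂ _+_ (inside zero z≤n (s≤s z≤n))
  (∑-interval zero w (h ∘ suc) (f ∘ suc) w≤n (λ _ ())
    (λ i _ i<w → inside (suc i) z≤n (s≤s i<w)) (λ i w≤i → above (suc i) (s≤s w≤i)))
∑-interval (suc lo) w h f (s≤s ≤n) below inside above = cong₂ _+_ (below zero (s≤s z≤n))
  (∑-interval lo w (h ∘ suc) (f ∘ suc) ≤n (λ i i<lo → below (suc i) (s≤s i<lo))
    (λ i lo≤i i< → inside (suc i) (s≤s lo≤i) (s≤s i<)) (λ i ≤i → above (suc i) (s≤s ≤i)))

-- For the patterns counted by formulas, the values that may follow, or precede, a given one form an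
-- interval: an initial segment, a final segment or a single value.
∑-if-interval : ∀ lo w {P : Fin n → Set} (P? : ∀ i → Dec (P i)) (f : ℕ → ℕ) → lo + w ≤ n →
                (∀ i → P i ⇔ (lo ≤ toℕ i × toℕ i < lo + w)) →
                ∑[ i < n ] (if does (P? i) then f (toℕ i) else 0) ≡ ∑[ t < w ] f (lo + toℕ t)
∑-if-interval {n} lo w {P} P? f ≤n P⇔ = ∑-interval lo w _ f ≤n below inside above
  where
  h : Fin n → ℕ
  h i = if does (P? i) then f (toℕ i) else 0
  off : ∀ i → ¬ P i → h i ≡ 0
  off i ¬p with P? i
  ... | yes p = contradiction p ¬p
  ... | no  _ = refl
  below : ∀ i → toℕ i < lo → h i ≡ 0
  below i i<lo = off i λ p → <⇒≱ i<lo (proj₁ (to (P⇔ i) p))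
  inside : ∀ i → lo ≤ toℕ i → toℕ i < lo + w → h i ≡ f (toℕ i)
  inside i lo≤ <hi with P? i
  ... | yes _ = refl
  ... | no ¬p = contradiction (from (P⇔ i) (lo≤ , <hi)) ¬p
  above : ∀ i → lo + w ≤ toℕ i → h i ≡ 0
  above i hi≤ = off i λ p → <⇒≱ (proj₂ (to (P⇔ i) p)) hi≤

module _ {P : Fin n → Set} (P? : ∀ i → Dec (P i)) (f : ℕ → ℕ) where

  ∑-if-below : ∀ w → w ≤ n → (∀ i → P i ⇔ toℕ i < w) →
               ∑[ i < n ] (if does (P? i) then f (toℕ i) else 0) ≡ ∑[ t < w ] f (toℕ t)
  ∑-if-below w w≤n P⇔ = ∑-if-interval 0 w P? f w≤n λ i →
    mk⇔ (λ p → z≤n , to (P⇔ i) p) (from (P⇔ i) ∘ proj₂)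

  ∑-if-above : ∀ lo → lo ≤ n → (∀ i → P i ⇔ lo ≤ toℕ i) →
               ∑[ i < n ] (if does (P? i) then f (toℕ i) else 0) ≡ ∑[ t < n ∸ lo ] f (lo + toℕ t)
  ∑-if-above lo lo≤n P⇔ = ∑-if-interval lo (n ∸ lo) P? f (≤-reflexive (m+[n∸m]≡n lo≤n)) λ i →
    mk⇔ (λ p → to (P⇔ i) p , ≤-trans (toℕ<n i) (≤-reflexive (sym (m+[n∸m]≡n lo≤n)))) (from (P⇔ i) ∘ proj₁)

  ∑-if-single : ∀ c → c < n → (∀ i → P i ⇔ toℕ i ≡ c) →
                ∑[ i < n ] (if does (P? i) then f (toℕ i) else 0) ≡ f c
  ∑-if-single c c<n P⇔ = trans (∑-if-interval c 1 P? f (subst (_≤ n) (+-comm 1 c) c<n) λ i → mk⇔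
      (λ p → let eq = to (P⇔ i) p in ≤-reflexive (sym eq) , ≤-reflexive (trans (cong suc eq) (+-comm 1 c)))
      λ (c≤i , i<c+1) → from (P⇔ i) (≤-antisym (s≤s⁻¹ (subst (toℕ i <_) (+-comm c 1) i<c+1)) c≤i))
    (trans (+-identityʳ _) (cong f (+-identityʳ c)))

-- Admissible steps as conditions on consecutive last values

descent⇔ : ∀ (v : Fin (suc n)) r → toℕ v < toℕ (punchIn v r) ⇔ toℕ v ≤ toℕ r
descent⇔ v r = mk⇔
  (λ lt → ≮⇒≥ λ r<v → <-asym r<v (subst (toℕ v <_) (toℕ-punchIn-< v r r<v) lt))
  -- The tie v = r belongs to the descents because `punchIn v` lifts r to r + 1.
  (λ v≤r → subst (toℕ v <_) (sym (toℕ-punchIn-≥ v r v≤r)) (s≤s v≤r))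

ascent⇔ : ∀ (v : Fin (suc n)) r → toℕ (punchIn v r) < toℕ v ⇔ toℕ r < toℕ v
ascent⇔ v r = mk⇔
  (λ lt → ≰⇒> λ v≤r → <-asym lt (from (descent⇔ v r) v≤r))
  (λ r<v → subst (_< toℕ v) (sym (toℕ-punchIn-< v r r<v)) r<v)

module Steps (p : Vec ℕ 3) (k : ℕ) where
  open Codes p k

  Avoids : Fin n → Fin (suc n) → Set
  Avoids r v = ∀ y → y ≢ r → ¬ SameOrder p (toℕ (punchIn v y) ∷ toℕ (punchIn v r) ∷ toℕ v ∷ [])

  step-descent : ∀ {r : Fin n} {v} → k ∣ n → Step r v ⇔ (toℕ v ≤ toℕ r × Avoids r v)
  step-descent {r = r} {v} k∣n = mk⇔
    (λ ((d , _) , av) → to (descent⇔ v r) (d k∣n) , av)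
    (λ (v≤r , av) → ((λ _ → from (descent⇔ v r) v≤r) , contradiction k∣n) , av)

  step-ascent : ∀ {r : Fin n} {v} → ¬ k ∣ n → Step r v ⇔ (toℕ r < toℕ v × Avoids r v)
  step-ascent {r = r} {v} ∤n = mk⇔
    (λ ((_ , a) , av) → to (ascent⇔ v r) (a ∤n) , av)
    (λ (r<v , av) → ((λ k∣n → contradiction k∣n ∤n) , λ _ → from (ascent⇔ v r) r<v) , av)

  -- When the last two letters of the pattern ascend, a descent cannot end an occurrence, so only v
  -- ≤ r remains. `free-ascent` is the mirror case.
  free-descent : lookup p 1F < lookup p 2F → ∀ {r : Fin n} {v} → k ∣ n → Step r v ⇔ toℕ v < suc (toℕ r)
  free-descent b<c {r} {v} k∣n = mk⇔ (s≤s ∘ proj₁ ∘ to (step-descent k∣n)) λ v<1+r →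
    from (step-descent k∣n) (s≤s⁻¹ v<1+r , λ y y≢r same → <⇒≱ (to (ascent⇔ v r) (to (same 1F 2F) b<c)) (s≤s⁻¹ v<1+r))

  free-ascent : lookup p 2F < lookup p 1F → ∀ {r : Fin n} {v} → ¬ k ∣ n → Step r v ⇔ toℕ r < toℕ v
  free-ascent c<b {r} {v} ∤n = mk⇔ (proj₁ ∘ to (step-ascent ∤n)) λ r<v →
    from (step-ascent ∤n) (r<v , λ y y≢r same → <⇒≱ r<v (to (descent⇔ v r) (to (same 2F 1F) c<b)))

module _ (k : ℕ) where

  module 132-Steps where
    open Codes (1 ∷ 3 ∷ 2 ∷ []) k
    open Steps (1 ∷ 3 ∷ 2 ∷ []) k

    -- If v is positive, the value just below v keeps its label and stands left of r, from which it
    -- differs as v ≤ r; with r and v it forms 1-32. For v = 0 no letter can play the 1.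
    tight-descent : ∀ {r : Fin n} {v} → k ∣ n → Step r v ⇔ toℕ v ≡ 0
    tight-descent {n} {r} {v} k∣n = mk⇔ (λ s → ⇒ (to (step-descent k∣n) s)) ⇐
      where
      ⇒ : (toℕ v ≤ toℕ r × Avoids r v) → toℕ v ≡ 0
      ⇒ (v≤r , av) with toℕ v in eq
      ... | zero  = refl
      ... | suc u = contradiction
        (sameOrder-sorted (subst (_< suc u) (sym y′≡) (n<1+n u))
          (subst (_< toℕ (punchIn v r)) eq (from (descent⇔ v r) (subst (_≤ toℕ r) (sym eq) v≤r))) (0F ∷ 2F ∷ 1F ∷ []))
        (av y λ y≡r → <⇒≢ v≤r (trans (sym (toℕ-fromℕ< u<n)) (cong toℕ y≡r)))
        where
        u<n : u < n
        u<n = ≤-trans v≤r (<⇒≤ (toℕ<n r))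
        y : Fin n
        y = fromℕ< u<n
        y′≡ : toℕ (punchIn v y) ≡ u
        y′≡ = trans (toℕ-punchIn-< v y (≤-reflexive (trans (cong suc (toℕ-fromℕ< u<n)) (sym eq)))) (toℕ-fromℕ< u<n)
      ⇐ : toℕ v ≡ 0 → Step r v
      ⇐ v≡0 = from (step-descent k∣n) (subst (_≤ toℕ r) (sym v≡0) z≤n , λ y _ same →
        n≮0 (subst (toℕ (punchIn v y) <_) v≡0 (to (same 0F 2F) (<ᵇ⇒< 1 2 _))))

  module 213-Steps where
    open Codes (2 ∷ 1 ∷ 3 ∷ []) k
    open Steps (2 ∷ 1 ∷ 3 ∷ []) k

    -- If v exceeds r + 1, the old value r + 1 keeps its label and stands left of r; with r and v it
    -- forms 2-13. For v = r + 1 no value fits strictly between r and v.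
    tight-ascent : ∀ {r : Fin n} {v} → ¬ k ∣ n → Step r v ⇔ toℕ v ≡ suc (toℕ r)
    tight-ascent {n} {r} {v} ∤n = mk⇔ (λ s → ⇒ (to (step-ascent ∤n) s)) ⇐
      where
      ⇒ : (toℕ r < toℕ v × Avoids r v) → toℕ v ≡ suc (toℕ r)
      ⇒ (r<v , av) with suc (toℕ r) ≟ toℕ v
      ... | yes eq = sym eq
      ... | no  ≢v = contradiction
        (sameOrder-sorted (subst₂ _<_ (sym (toℕ-punchIn-< v r r<v)) (sym y′≡) (n<1+n _))
          (subst (_< toℕ v) (sym y′≡) y<v) (1F ∷ 0F ∷ 2F ∷ []))
        (av y λ y≡r → <⇒≢ (n<1+n _) (trans (sym (cong toℕ y≡r)) (toℕ-fromℕ< y<n)))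
        where
        y<v : suc (toℕ r) < toℕ v
        y<v = ≤∧≢⇒< r<v ≢v
        y<n : suc (toℕ r) < n
        y<n = ≤-trans y<v (toℕ≤pred[n] v)
        y : Fin n
        y = fromℕ< y<n
        y′≡ : toℕ (punchIn v y) ≡ suc (toℕ r)
        y′≡ = trans (toℕ-punchIn-< v y (subst (_< toℕ v) (sym (toℕ-fromℕ< y<n)) y<v)) (toℕ-fromℕ< y<n)
      ⇐ : toℕ v ≡ suc (toℕ r) → Step r v
      ⇐ v≡ = from (step-ascent ∤n) (r<v , λ y _ same →
        <⇒≱ (subst (_< toℕ (punchIn v y)) (toℕ-punchIn-< v r r<v) (to (same 1F 0F) (<ᵇ⇒< 1 2 _)))
            (s≤s⁻¹ (subst (toℕ (punchIn v y) <_) v≡ (to (same 0F 2F) (<ᵇ⇒< 2 3 _)))))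
        where
        r<v : toℕ r < toℕ v
        r<v = ≤-reflexive (sym v≡)

  module 231-Steps where
    open Codes (2 ∷ 3 ∷ 1 ∷ []) k
    open Steps (2 ∷ 3 ∷ 1 ∷ []) k

    -- If v < r, the old value r - 1 becomes r and r becomes r + 1, so with v they form 2-31. For v
    -- = r the last letter becomes v + 1, leaving no room for the 2. The equation has r on the left
    -- because it selects a summand in sums over r.
    tight-descent : ∀ {r : Fin n} {v} → k ∣ n → Step r v ⇔ toℕ r ≡ toℕ v
    tight-descent {n} {r} {v} k∣n = mk⇔ (λ s → ⇒ (to (step-descent k∣n) s)) ⇐
      where
      ⇒ : (toℕ v ≤ toℕ r × Avoids r v) → toℕ r ≡ toℕ v
      ⇒ (v≤r , av) with toℕ r in eq
      ... | zero = sym (n≤0⇒n≡0 v≤r)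
      ... | suc u with toℕ v ≟ suc u
      ... | yes eq′ = sym eq′
      ... | no  ≢r  = contradiction
        (sameOrder-sorted (subst (toℕ v <_) (sym y′≡) (s≤s v≤u))
          (subst₂ _<_ (sym y′≡) (sym (trans (toℕ-punchIn-≥ v r (subst (toℕ v ≤_) (sym eq) v≤r)) (cong suc eq))) (n<1+n _)) (1F ∷ 2F ∷ 0F ∷ []))
        (av y λ y≡r → <⇒≢ (n<1+n _) (trans (sym (toℕ-fromℕ< u<n)) (trans (cong toℕ y≡r) eq)))
        where
        v≤u : toℕ v ≤ u
        v≤u = s≤s⁻¹ (≤∧≢⇒< v≤r ≢r)
        u<n : u < n
        u<n = <⇒≤ (subst (_< n) eq (toℕ<n r))
        y : Fin n
        y = fromℕ< u<n
        y′≡ : toℕ (punchIn v y) ≡ suc u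
        y′≡ = trans (toℕ-punchIn-≥ v y (subst (toℕ v ≤_) (sym (toℕ-fromℕ< u<n)) v≤u)) (cong suc (toℕ-fromℕ< u<n))
      ⇐ : toℕ r ≡ toℕ v → Step r v
      ⇐ r≡v = from (step-descent k∣n) (≤-reflexive (sym r≡v) , λ y _ same →
        <⇒≱ (to (same 2F 0F) (<ᵇ⇒< 1 2 _))
            (s≤s⁻¹ (subst (toℕ (punchIn v y) <_)
              (trans (toℕ-punchIn-≥ v r (≤-reflexive (sym r≡v))) (cong suc r≡v)) (to (same 0F 1F) (<ᵇ⇒< 2 3 _)))))

  module 312-Steps where
    open Codes (3 ∷ 1 ∷ 2 ∷ []) k
    open Steps (3 ∷ 1 ∷ 2 ∷ []) k

    -- If v is not the new maximum, the old maximum is lifted above v; it is not r because r < v,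
    -- and it forms 3-12 with r and v. Above v = n no letter can play the 3.
    tight-ascent : ∀ {r : Fin n} {v} → ¬ k ∣ n → Step r v ⇔ toℕ v ≡ n
    tight-ascent {suc n} {r} {v} ∤n = mk⇔ (λ s → ⇒ (to (step-ascent ∤n) s)) ⇐
      where
      top : toℕ (fromℕ n) ≡ n
      top = toℕ-fromℕ n
      ⇒ : (toℕ r < toℕ v × Avoids r v) → toℕ v ≡ suc n
      ⇒ (r<v , av) with toℕ v ≟ suc n
      ... | yes eq = eq
      ... | no  ≢n = contradiction
        (sameOrder-sorted (from (ascent⇔ v r) r<v) (subst (toℕ v <_) (sym y′≡) (s≤s v≤n)) (2F ∷ 0F ∷ 1F ∷ []))
        (av (fromℕ n) λ y≡r → <⇒≢ (<-≤-trans r<v v≤n) (trans (sym (cong toℕ y≡r)) top))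
        where
        v≤n : toℕ v ≤ n
        v≤n = s≤s⁻¹ (≤∧≢⇒< (toℕ≤pred[n] v) ≢n)
        y′≡ : toℕ (punchIn v (fromℕ n)) ≡ suc n
        y′≡ = trans (toℕ-punchIn-≥ v (fromℕ n) (subst (toℕ v ≤_) (sym top) v≤n)) (cong suc top)
      ⇐ : toℕ v ≡ suc n → Step r v
      ⇐ v≡ = from (step-ascent ∤n) (subst (toℕ r <_) (sym v≡) (toℕ<n r) , λ y _ same →
        <⇒≱ (to (same 2F 0F) (<ᵇ⇒< 2 3 _)) (subst (toℕ (punchIn v y) ≤_) (sym v≡) (toℕ≤pred[n] (punchIn v y))))

-- Binomial coefficients and Raney numbers

∑-last : ∀ n (f : ℕ → ℕ) → ∑[ t < suc n ] f (toℕ t) ≡ ∑[ t < n ] f (toℕ t) + f n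
∑-last zero    f = +-identityʳ (f 0)
∑-last (suc n) f = trans (cong (f 0 +_) (∑-last n (f ∘ suc))) (sym (+-assoc (f 0) _ _))

∑-const : ∀ n c → ∑[ t < n ] c ≡ n * c
∑-const zero    c = refl
∑-const (suc n) c = cong (c +_) (∑-const n c)

C-absorb : ∀ n l → suc l * (suc n C suc l) ≡ suc n * (n C l)
C-absorb zero zero    = refl
C-absorb zero (suc l) = *-zeroʳ (suc (suc l))
C-absorb (suc n) zero = trans (*-identityˡ (suc (suc n) C 1)) (trans (nC1≡n (suc (suc n))) (sym (*-identityʳ _)))
C-absorb (suc n) (suc l) = begin
  suc (suc l) * (suc (suc n) C suc (suc l))
    ≡⟨ cong (suc (suc l) *_) (nCk+nC[k+1]≡[n+1]C[k+1] (suc n) (suc l)) ⟨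
  suc (suc l) * (X + (suc n C suc (suc l)))
    ≡⟨ *-distribˡ-+ (suc (suc l)) X _ ⟩
  (X + suc l * X) + suc (suc l) * (suc n C suc (suc l))
    ≡⟨ cong₂ (λ a b → (X + a) + b) (C-absorb n l) (C-absorb n (suc l)) ⟩
  (X + suc n * (n C l)) + suc n * (n C suc l)
    ≡⟨ +-assoc X _ _ ⟩
  X + (suc n * (n C l) + suc n * (n C suc l))
    ≡⟨ cong (X +_) (*-distribˡ-+ (suc n) (n C l) _) ⟨
  X + suc n * (n C l + n C suc l)
    ≡⟨ cong (λ a → X + suc n * a) (nCk+nC[k+1]≡[n+1]C[k+1] n l) ⟩
  suc (suc n) * X ∎
  where
  open ≡-Reasoning
  X = suc n C suc l

C-factorial : ∀ a b → ((a + b) C a) * (a ! * b !) ≡ (a + b) !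
C-factorial zero    b = trans (+-identityʳ _) (+-identityʳ _)
C-factorial (suc a) b = begin
  (suc (a + b) C suc a) * (suc a * a ! * b !)   ≡⟨ rearrange (suc (a + b) C suc a) (suc a) (a !) (b !) ⟩
  (suc a * (suc (a + b) C suc a)) * (a ! * b !) ≡⟨ cong (_* (a ! * b !)) (C-absorb (a + b) a) ⟩
  suc (a + b) * ((a + b) C a) * (a ! * b !)     ≡⟨ *-assoc (suc (a + b)) ((a + b) C a) (a ! * b !) ⟩
  suc (a + b) * (((a + b) C a) * (a ! * b !))   ≡⟨ cong (suc (a + b) *_) (C-factorial a b) ⟩
  suc (a + b) * (a + b) !                       ∎
  where
  open ≡-Reasoning
  rearrange : ∀ c s x y → c * (s * x * y) ≡ (s * c) * (x * y)
  rearrange = solve-∀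

-- Adding (l + 1) C(l + d, l) to both sides turns the left one, by Pascal's rule, into an instance
-- of `C-absorb`.
C-suc : ∀ l d → suc l * ((l + d) C suc l) ≡ d * ((l + d) C l)
C-suc l d = +-cancelˡ-≡ (suc l * X) _ _ (begin
  suc l * X + suc l * ((l + d) C suc l) ≡⟨ *-distribˡ-+ (suc l) X _ ⟨
  suc l * (X + ((l + d) C suc l))       ≡⟨ cong (suc l *_) (nCk+nC[k+1]≡[n+1]C[k+1] (l + d) l) ⟩
  suc l * (suc (l + d) C suc l)         ≡⟨ C-absorb (l + d) l ⟩
  (suc l + d) * X                       ≡⟨ *-distribʳ-+ X (suc l) d ⟩
  suc l * X + d * X                     ∎)
  where
  open ≡-Reasoning
  X = (l + d) C l

-- The summands start from the largest upper index, so Pascal's rule joins the first one to the sum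
-- of the rest.
C-hockey-stick : ∀ d j → ∑[ t < suc d ] ((d ∸ toℕ t + j) C j) ≡ (d + suc j) C suc j
C-hockey-stick zero j = trans (+-identityʳ (j C j)) (trans (nCn≡1 j) (sym (nCn≡1 (suc j))))
C-hockey-stick (suc d) j = trans (cong (((suc d + j) C j) +_) (C-hockey-stick d j))
  (trans (cong (λ a → ((suc d + j) C j) + (a C suc j)) (+-suc d j))
    (trans (nCk+nC[k+1]≡[n+1]C[k+1] (suc d + j) j) (cong (_C suc j) (cong suc (sym (+-suc d j))))))

∏-last : ∀ m f → ∏[1≤j≤ suc m ] f ≡ (∏[1≤j≤ m ] f) * f (suc m)
∏-last zero    f = *-comm (f 1) 1
∏-last (suc m) f = trans (cong (f 1 *_) (∏-last m (f ∘ suc))) (sym (*-assoc (f 1) _ _))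

module _ (k′ : ℕ) where

  private
    k = suc k′

  -- The index n = m k + b stands for size n + 1: m descents have been passed and b letters of the
  -- current block precede the last one. The step to n + 1 is a descent exactly when k divides n +
  -- 1, that is, when b = k′.
  block-induction : (P : (n m b : ℕ) → Set) → P 0 0 0 →
    (∀ {n m b} → b < k′ → ¬ k ∣ suc n → n ≡ m * k + b → P n m b → P (suc n) m (suc b)) →
    (∀ {n m} → k ∣ suc n → n ≡ m * k + k′ → P n m k′ → P (suc n) (suc m) 0) →
    ∀ m b → b ≤ k′ → P (m * k + b) m b
  block-induction P base asc desc = go
    where
    go : ∀ m b → b ≤ k′ → P (m * k + b) m b
    go zero    zero    _    = base
    go m       (suc b) b<k′ = subst (λ n → P n m (suc b)) (sym (+-suc (m * k) b))
      (asc b<k′ (λ k∣ → >⇒∤ (s≤s b<k′) (∣m+n∣m⇒∣n (subst (k ∣_) (sym (+-suc (m * k) b)) k∣) (n∣m*n m)))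
        refl (go m b (<⇒≤ b<k′)))
    go (suc m) zero    _    = subst (λ n → P n (suc m) 0) eq
      (desc (subst (k ∣_) (sym eq) (∣m∣n⇒∣m+n (n∣m*n (suc m)) (k ∣0))) refl (go m k′ ≤-refl))
      where
      eq : suc (m * k + k′) ≡ suc m * k + 0
      eq = trans (cong suc (+-comm (m * k) k′)) (sym (+-identityʳ _))

  -- raney l x = [zˡ] 𝔅(z)ˣ, where 𝔅 = 1 + z 𝔅ᵏ
  raney : ℕ → ℕ → ℕ
  raney zero    x       = 1
  raney (suc l) zero    = 0
  raney (suc l) (suc x) = raney (suc l) x + raney l (x + k)

  ∑-raney : ∀ l x → ∑[ t < x ] raney l (toℕ t + k) ≡ raney (suc l) x
  ∑-raney l zero    = refl
  ∑-raney l (suc x) = trans (∑-last x (λ t → raney l (t + k))) (cong (_+ raney l (x + k)) (∑-raney l x))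

  -- The formula C(M, l + 1) - k′ C(M, l) with M = x + k′ + k l, written without subtraction.
  -- Induction on x plays Pascal's rule against the recursion of `raney`; at x = 0 the two terms
  -- cancel by `C-suc`.
  raney-C : ∀ l x → raney (suc l) x + k′ * ((x + k′ + k * l) C l) ≡ (x + k′ + k * l) C suc l
  raney-C l zero = *-cancelˡ-≡ _ _ (suc l) (begin
    suc l * (k′ * ((k′ + k * l) C l)) ≡⟨ cong (λ a → suc l * (k′ * (a C l))) (split k′ l) ⟩
    suc l * (k′ * ((l + k′ * suc l) C l)) ≡⟨ rearrange (suc l) k′ _ ⟩
    k′ * suc l * ((l + k′ * suc l) C l)   ≡⟨ C-suc l (k′ * suc l) ⟨
    suc l * ((l + k′ * suc l) C suc l)    ≡⟨ cong (λ a → suc l * (a C suc l)) (split k′ l) ⟨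
    suc l * ((k′ + k * l) C suc l)        ∎)
    where
    open ≡-Reasoning
    split : ∀ k′ l → k′ + suc k′ * l ≡ l + k′ * suc l
    split = solve-∀
    rearrange : ∀ a b c → a * (b * c) ≡ b * a * c
    rearrange = solve-∀
  raney-C zero (suc x) = begin
    raney 1 x + 1 + k′ * 1   ≡⟨ rearrange (raney 1 x) (k′ * 1) ⟩
    1 + (raney 1 x + k′ * 1) ≡⟨ cong (1 +_) (raney-C zero x) ⟩
    1 + (M C 1)              ≡⟨ nCk+nC[k+1]≡[n+1]C[k+1] M 0 ⟩
    suc M C 1                ∎
    where
    open ≡-Reasoning
    M = x + k′ + k * 0
    rearrange : ∀ a b → a + 1 + b ≡ 1 + (a + b)
    rearrange = solve-∀
  raney-C (suc l) (suc x) = begin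
    raney (suc (suc l)) x + raney (suc l) (x + k) + k′ * (suc M C suc l)
      ≡⟨ cong (λ a → raney (suc (suc l)) x + raney (suc l) (x + k) + k′ * a) (nCk+nC[k+1]≡[n+1]C[k+1] M l) ⟨
    raney (suc (suc l)) x + raney (suc l) (x + k) + k′ * (M C l + M C suc l)
      ≡⟨ rearrange (raney (suc (suc l)) x) (raney (suc l) (x + k)) k′ (M C l) (M C suc l) ⟩
    (raney (suc l) (x + k) + k′ * (M C l)) + (raney (suc (suc l)) x + k′ * (M C suc l))
      -- The instances at (l, x + k) and (l + 1, x) share the upper index M.
      ≡⟨ cong₂ _+_ (subst (λ a → raney (suc l) (x + k) + k′ * (a C l) ≡ a C suc l) (shift x k′ l) (raney-C l (x + k))) (raney-C (suc l) x) ⟩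
    M C suc l + M C suc (suc l)
      ≡⟨ nCk+nC[k+1]≡[n+1]C[k+1] M (suc l) ⟩
    suc M C suc (suc l) ∎
    where
    open ≡-Reasoning
    M = x + k′ + k * suc l
    shift : ∀ x k′ l → x + suc k′ + k′ + suc k′ * l ≡ x + k′ + suc k′ * suc l
    shift = solve-∀
    rearrange : ∀ a b c d e → a + b + c * (d + e) ≡ (b + c * d) + (a + c * e)
    rearrange = solve-∀

  raney-closed : ∀ m s → (m * k + s) * raney m s ≡ s * ((m * k + s) C m)
  raney-closed zero    s = refl
  -- Adding k (l + 1) Q lets absorption replace (l + 1) Q by (M + 1) C(M, l), so that `raney-C`
  -- applies; afterwards M + 1 = s + k (l + 1) splits off the same term.
  raney-closed (suc l) s = subst (λ N → N * A ≡ s * (N C suc l)) (N≡ s k′ l) (+-cancelʳ-≡ (k * suc l * Q) _ _ (begin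
    suc M * A + k * suc l * Q                     ≡⟨ rearrange (suc M) A k′ (suc l) Q ⟩
    suc M * A + k′ * (suc l * Q) + suc l * Q      ≡⟨ cong (λ a → suc M * A + k′ * a + a) (C-absorb M l) ⟩
    suc M * A + k′ * (suc M * (M C l)) + suc M * (M C l)
                                                  ≡⟨ rearrange′ (suc M) A k′ (M C l) ⟩
    suc M * (M C l + (A + k′ * (M C l)))          ≡⟨ cong (λ a → suc M * (M C l + a)) (raney-C l s) ⟩
    suc M * (M C l + M C suc l)                   ≡⟨ cong (suc M *_) (nCk+nC[k+1]≡[n+1]C[k+1] M l) ⟩
    suc M * Q                                     ≡⟨ cong (_* Q) (sucM≡ s k′ l) ⟩
    (s + k * suc l) * Q                           ≡⟨ *-distribʳ-+ Q s (k * suc l) ⟩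
    s * Q + k * suc l * Q                         ∎))
    where
    open ≡-Reasoning
    M = s + k′ + k * l
    A = raney (suc l) s
    Q = suc M C suc l
    N≡ : ∀ s k′ l → suc (s + k′ + suc k′ * l) ≡ suc l * suc k′ + s
    N≡ = solve-∀
    sucM≡ : ∀ s k′ l → suc (s + k′ + suc k′ * l) ≡ s + suc k′ * suc l
    sucM≡ = solve-∀
    rearrange : ∀ M A k′ l Q → M * A + suc k′ * l * Q ≡ M * A + k′ * (l * Q) + l * Q
    rearrange = solve-∀
    rearrange′ : ∀ M A k′ c → M * A + k′ * (M * c) + M * c ≡ M * (c + (A + k′ * c))
    rearrange′ = solve-∀

  -- The case s = k of `raney-closed`, where a factor k cancels; `C-suc` then raises the lower index
  -- from m to m + 1.
  raney-fuss-catalan : ∀ m → (k′ * (m + 1) + 1) * raney m k ≡ (k * (m + 1)) C (m + 1)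
  raney-fuss-catalan m = *-cancelˡ-≡ _ _ (suc m) (begin
    suc m * (c * raney m k)            ≡⟨ rearrange (suc m) c (raney m k) ⟩
    c * (suc m * raney m k)            ≡⟨ cong (c *_) (*-cancelˡ-≡ _ _ k
                                            (trans (trans (sym (*-assoc k (suc m) _)) (cong (_* raney m k) (kK m k′))) (raney-closed m k))) ⟩
    c * ((m * k + k) C m)              ≡⟨ cong (λ a → c * (a C m)) (K≡ m k′) ⟩
    c * ((m + c) C m)                  ≡⟨ C-suc m c ⟨
    suc m * ((m + c) C suc m)          ≡⟨ cong (suc m *_) (cong₂ _C_ (K≡′ m k′) (+-comm 1 m)) ⟩
    suc m * ((k * (m + 1)) C (m + 1))  ∎)
    where
    open ≡-Reasoning
    c = k′ * (m + 1) + 1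
    kK : ∀ m k′ → suc k′ * suc m ≡ m * suc k′ + suc k′
    kK = solve-∀
    K≡ : ∀ m k′ → m * suc k′ + suc k′ ≡ m + (k′ * (m + 1) + 1)
    K≡ = solve-∀
    K≡′ : ∀ m k′ → m + (k′ * (m + 1) + 1) ≡ suc k′ * (m + 1)
    K≡′ = solve-∀
    rearrange : ∀ a b c → a * (b * c) ≡ b * (a * c)
    rearrange = solve-∀

  -- The number of permutations of m full blocks for 1-32.
  blocks : ℕ → ℕ
  blocks zero    = 1
  blocks (suc m) = blocks m * ((m * k + k′) C k′)

  -- Thus `blocks m` is the number of partitions of a set of m k elements into m blocks of size k.
  blocks-factorial : ∀ m → blocks m * (m ! * (k !) ^ m) ≡ (m * k) !
  blocks-factorial zero    = refl
  blocks-factorial (suc m) = begin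
    blocks m * c * (suc m * m ! * (k * k′ ! * (k !) ^ m))
      ≡⟨ rearrange (blocks m) c (suc m) (m !) k (k′ !) ((k !) ^ m) ⟩
    suc m * k * (c * (k′ ! * (blocks m * (m ! * (k !) ^ m))))
      ≡⟨ cong (λ a → suc m * k * (c * (k′ ! * a))) (blocks-factorial m) ⟩
    suc m * k * (c * (k′ ! * (m * k) !))
      ≡⟨ cong (λ a → suc m * k * ((a C k′) * (k′ ! * (m * k) !))) (+-comm (m * k) k′) ⟩
    suc m * k * (((k′ + m * k) C k′) * (k′ ! * (m * k) !))
      ≡⟨ cong (suc m * k *_) (C-factorial k′ (m * k)) ⟩
    (suc m * k) ! ∎
    where
    open ≡-Reasoning
    c = (m * k + k′) C k′
    rearrange : ∀ a b c d e f g → a * b * (c * d * (e * f * g)) ≡ c * e * (b * (f * (a * (d * g))))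
    rearrange = solve-∀

  ∏-C-factorial : ∀ b m → (∏[1≤j≤ m ] (λ j → (b + j * k) C k)) * ((k !) ^ m * b !) ≡ (b + m * k) !
  ∏-C-factorial b zero = trans (+-identityʳ (b ! + 0)) (trans (+-identityʳ (b !)) (cong _! (sym (+-identityʳ b))))
  ∏-C-factorial b (suc m) = begin
    (∏[1≤j≤ suc m ] g) * (k ! * (k !) ^ m * b !) ≡⟨ cong (_* (k ! * (k !) ^ m * b !)) (∏-last m g) ⟩
    (∏[1≤j≤ m ] g) * g (suc m) * (k ! * (k !) ^ m * b !) ≡⟨ rearrange (∏[1≤j≤ m ] g) (g (suc m)) (k !) ((k !) ^ m) (b !) ⟩
    g (suc m) * (k ! * ((∏[1≤j≤ m ] g) * ((k !) ^ m * b !))) ≡⟨ cong (λ a → g (suc m) * (k ! * a)) (∏-C-factorial b m) ⟩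
    g (suc m) * (k ! * (b + m * k) !) ≡⟨ cong (λ a → (a C k) * (k ! * (b + m * k) !)) (shift b m k′) ⟩
    ((k + (b + m * k)) C k) * (k ! * (b + m * k) !) ≡⟨ C-factorial k (b + m * k) ⟩
    (k + (b + m * k)) ! ≡⟨ cong _! (shift b m k′) ⟨
    (b + suc m * k) ! ∎
    where
    open ≡-Reasoning
    g : ℕ → ℕ
    g j = (b + j * k) C k
    shift : ∀ b m k′ → b + suc m * suc k′ ≡ suc k′ + (b + m * suc k′)
    shift = solve-∀
    rearrange : ∀ a b c d e → a * b * (c * d * e) ≡ b * (c * (a * (d * e)))
    rearrange = solve-∀

  blocks-closed : ∀ m b → m ! * (blocks m * ((m * k + b) C b)) ≡ ∏[1≤j≤ m ] (λ j → (b + j * k) C k)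
  -- After multiplication by (k!)^m b!, both sides become (b + m k)!.
  blocks-closed m b = *-cancelʳ-≡ _ _ ((k !) ^ m * b !) {{m*n≢0 _ _ {{m^n≢0 (k !) m {{k !≢0}}}} {{b !≢0}}}} (begin
    m ! * (blocks m * c) * ((k !) ^ m * b !)   ≡⟨ rearrange (m !) (blocks m) c ((k !) ^ m) (b !) ⟩
    c * (b ! * (blocks m * (m ! * (k !) ^ m))) ≡⟨ cong (λ a → c * (b ! * a)) (blocks-factorial m) ⟩
    c * (b ! * (m * k) !)                      ≡⟨ cong (λ a → (a C b) * (b ! * (m * k) !)) (+-comm (m * k) b) ⟩
    ((b + m * k) C b) * (b ! * (m * k) !)      ≡⟨ C-factorial b (m * k) ⟩
    (b + m * k) !                              ≡⟨ ∏-C-factorial b m ⟨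
    (∏[1≤j≤ m ] (λ j → (b + j * k) C k)) * ((k !) ^ m * b !) ∎)
    where
    open ≡-Reasoning
    c = (m * k + b) C b
    rearrange : ∀ a b c d e → a * (b * c) * (d * e) ≡ c * (e * (b * (a * d)))
    rearrange = solve-∀

-- Counting for the individual patterns

m≤m*k+b : ∀ m k′ b → m ≤ m * suc k′ + b
m≤m*k+b m k′ b = ≤-trans (m≤m*n m (suc k′)) (m≤m+n (m * suc k′) b)

module 132-Count (k′ : ℕ) where
  private k = suc k′
  open Codes (1 ∷ 3 ∷ 2 ∷ []) k
  open Steps (1 ∷ 3 ∷ 2 ∷ []) k
  open 132-Steps k

  private
    -- the number of ways to append j ascents to a last value r among n + 1
    K : ℕ → ℕ → ℕ → ℕ
    K n j r = (n ∸ r + j) C j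

  E-ascent : ∀ {n} → ¬ k ∣ suc n → ∀ j → E (suc n) (K (suc n) j) ≡ E n (K n (suc j))
  E-ascent {n} ∤n j = E-suc n (K (suc n) j) (K n (suc j)) λ r → let r≤n = toℕ≤pred[n] r in begin
    ∑[ v ≤ suc n ] (if does (step? r v) then K (suc n) j (toℕ v) else 0)
      ≡⟨ ∑-if-above (step? r) (K (suc n) j) (suc (toℕ r)) (s≤s (m≤n⇒m≤1+n r≤n))
           (λ v → free-ascent (<ᵇ⇒< 2 3 _) ∤n) ⟩
    ∑[ t < suc n ∸ toℕ r ] K (suc n) j (suc (toℕ r + toℕ t))
      ≡⟨ cong (λ d → ∑[ t < d ] K (suc n) j (suc (toℕ r + toℕ t))) (+-∸-assoc 1 r≤n) ⟩
    ∑[ t < suc (n ∸ toℕ r) ] K (suc n) j (suc (toℕ r + toℕ t))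
      ≡⟨ sum-cong-≗ (λ (t : Fin (suc (n ∸ toℕ r))) → cong (λ d → (d + j) C j) (sym (∸-+-assoc n (toℕ r) (toℕ t)))) ⟩
    ∑[ t < suc (n ∸ toℕ r) ] ((n ∸ toℕ r ∸ toℕ t + j) C j)
      ≡⟨ C-hockey-stick (n ∸ toℕ r) j ⟩
    K n (suc j) (toℕ r) ∎
    where open ≡-Reasoning

  E-descent : ∀ {n} → k ∣ suc n → ∀ f → E (suc n) f ≡ E n (λ _ → f 0)
  E-descent {n} k∣n f = E-suc n f (λ _ → f 0) λ r → ∑-if-single (step? r) f 0 (s≤s z≤n) (λ v → tight-descent k∣n)

  E-one : ∀ n → E n (λ _ → 1) ≡ E n (K n 0)
  E-one n = E-cong n (λ _ → 1) (K n 0) λ _ _ → refl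

  -- Read backwards, each ascent raises j by the hockey-stick identity. A descent sends the last
  -- value to 0, where the weight is the constant C(n + 1 + j, j), so each completed block
  -- contributes an independent factor.
  E-K : ∀ m b → b ≤ k′ → ∀ j → E (m * k + b) (K (m * k + b) j) ≡ blocks k′ m * ((m * k + b + j) C (b + j))
  E-K = block-induction k′ (λ n m b → ∀ j → E n (K n j) ≡ blocks k′ m * ((n + j) C (b + j)))
    (λ j → +-identityʳ (1 * (j C j)))
    (λ {n} {m} {b} _ ∤n _ ih j → trans (E-ascent ∤n j) (trans (ih (suc j))
      (cong₂ (λ a c → blocks k′ m * (a C c)) (+-suc n j) (+-suc b j))))
    λ {n} {m} k∣n n≡ ih j → let c = (suc n + j) C j in begin
      E (suc n) (K (suc n) j)                 ≡⟨ E-descent k∣n (K (suc n) j) ⟩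
      E n (λ _ → c)                           ≡⟨ E-cong n (λ _ → c) (λ _ → c * 1) (λ _ _ → sym (*-identityʳ c)) ⟩
      E n (λ _ → c * 1)                       ≡⟨ E-* n c (λ _ → 1) ⟩
      c * E n (λ _ → 1)                       ≡⟨ cong (c *_) (trans (E-one n) (ih 0)) ⟩
      c * (blocks k′ m * ((n + 0) C (k′ + 0)))
        ≡⟨ cong (c *_) (cong (blocks k′ m *_) (cong₂ _C_ (trans (+-identityʳ n) n≡) (+-identityʳ k′))) ⟩
      c * blocks k′ (suc m)                   ≡⟨ *-comm c _ ⟩
      blocks k′ (suc m) * c                   ∎
    where open ≡-Reasoning

  total : ∀ m b → b ≤ k′ → E (m * k + b) (λ _ → 1) ≡ blocks k′ m * ((m * k + b) C b)
  total m b b≤k′ = trans (E-one (m * k + b)) (trans (E-K m b b≤k′ 0)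
    (cong₂ (λ a c → blocks k′ m * (a C c)) (+-identityʳ (m * k + b)) (+-identityʳ b)))

module 213-Count (k′ : ℕ) where
  private k = suc k′
  open Codes (2 ∷ 1 ∷ 3 ∷ []) k
  open Steps (2 ∷ 1 ∷ 3 ∷ []) k
  open 213-Steps k

  E-ascent : ∀ {n} → ¬ k ∣ suc n → ∀ f → E (suc n) f ≡ E n (f ∘ suc)
  E-ascent {n} ∤n f = E-suc n f (f ∘ suc) λ r →
    ∑-if-single (step? r) f (suc (toℕ r)) (s≤s (toℕ<n r)) (λ v → tight-ascent ∤n)

  E-descent : ∀ {n} → k ∣ suc n → ∀ f → E (suc n) f ≡ E n (λ r → ∑[ t < suc r ] f (toℕ t))
  E-descent {n} k∣n f = E-suc n f (λ r → ∑[ t < suc r ] f (toℕ t)) λ r →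
    ∑-if-below (step? r) f (suc (toℕ r)) (m≤n⇒m≤1+n (toℕ<n r)) (λ v → free-descent (<ᵇ⇒< 1 3 _) k∣n)

  -- The weight counts the continuations through l further descents. An ascent raises r by 1 and
  -- lowers k - b by 1, leaving the argument unchanged; a descent, read backwards, raises l by
  -- `∑-raney`.
  E-raney : ∀ m b → b ≤ k′ → ∀ l → E (m * k + b) (λ r → raney k′ l (r + (k ∸ b))) ≡ raney k′ (m + l) k
  E-raney = block-induction k′ (λ n m b → ∀ l → E n (λ r → raney k′ l (r + (k ∸ b))) ≡ raney k′ (m + l) k)
    (λ l → trans (+-identityʳ _) (+-identityʳ _))
    (λ {n} {m} {b} b<k′ ∤n _ ih l → trans (E-ascent ∤n (λ r → raney k′ l (r + (k ∸ suc b))))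
      (trans (E-cong n _ _ λ r _ → cong (raney k′ l)
        (trans (sym (+-suc r (k′ ∸ b))) (cong (r +_) (sym (+-∸-assoc 1 (<⇒≤ b<k′))))))
        (ih l)))
    λ {n} {m} k∣n _ ih l → trans (E-descent k∣n (λ r → raney k′ l (r + k)))
      (trans (E-cong n _ _ λ r _ → trans (∑-raney k′ l (suc r))
        (cong (raney k′ (suc l)) (trans (+-comm 1 r) (cong (r +_) (sym (m+n∸n≡m 1 k′))))))
        (trans (ih (suc l)) (cong (λ a → raney k′ a k) (+-suc m l))))

  total : ∀ m b → b ≤ k′ → E (m * k + b) (λ _ → 1) ≡ raney k′ m k
  total m b b≤k′ = trans (E-raney m b b≤k′ 0) (cong (λ a → raney k′ a k) (+-identityʳ m))

module 312-Count (k′ : ℕ) (1≤k′ : 1 ≤ k′) where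
  private k = suc k′
  open Codes (3 ∷ 1 ∷ 2 ∷ []) k
  open Steps (3 ∷ 1 ∷ 2 ∷ []) k
  open 312-Steps k

  E-ascent : ∀ {n} → ¬ k ∣ suc n → ∀ f → E (suc n) f ≡ E n (λ _ → f (suc n))
  E-ascent {n} ∤n f = E-suc n f (λ _ → f (suc n)) λ r → ∑-if-single (step? r) f (suc n) ≤-refl (λ v → tight-ascent ∤n)

  E-descent : ∀ {n} → k ∣ suc n → ∀ f → E (suc n) f ≡ E n (λ r → ∑[ t < suc r ] f (toℕ t))
  E-descent {n} k∣n f = E-suc n f (λ r → ∑[ t < suc r ] f (toℕ t)) λ r →
    ∑-if-below (step? r) f (suc (toℕ r)) (m≤n⇒m≤1+n (toℕ<n r)) (λ v → free-descent (<ᵇ⇒< 1 2 _) k∣n)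

  -- After an ascent the last value is the largest one, so only f at the top matters.
  E-top : ∀ m b → b ≤ k′ → ∀ f c → (b ≡ 0 → ∀ r → f r ≡ c) → f (m * k + b) ≡ c →
          E (m * k + b) f ≡ k ^ m * m ! * c
  E-top = block-induction k′ (λ n m b → ∀ f c → (b ≡ 0 → ∀ r → f r ≡ c) → f n ≡ c → E n f ≡ k ^ m * m ! * c)
    (λ f c _ f0≡c → trans (+-identityʳ (1 * f 0)) (cong (1 *_) f0≡c))
    (λ {n} _ ∤n _ ih f c _ fn≡c → trans (E-ascent ∤n f) (ih (λ _ → f (suc n)) c (λ _ _ → fn≡c) fn≡c))
    λ {n} {m} k∣n n≡ ih f c const _ → begin
      E (suc n) f
        ≡⟨ E-descent k∣n f ⟩
      E n (λ r → ∑[ t < suc r ] f (toℕ t))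
        -- Since k′ ≥ 1, the block just completed ends with an ascent, so only the weight at r = n
        -- matters: it sums f over n + 1 = (m + 1) k values.
        ≡⟨ ih (λ r → ∑[ t < suc r ] f (toℕ t)) (suc n * c) (λ k′≡0 → contradiction 1≤k′ (<-irrefl (sym k′≡0)))
             (trans (sum-cong-≗ {suc n} (λ t → const refl (toℕ t))) (∑-const (suc n) c)) ⟩
      k ^ m * m ! * (suc n * c)
        ≡⟨ cong (λ a → k ^ m * m ! * (a * c)) (cong suc (trans n≡ (+-comm (m * k) k′))) ⟩
      k ^ m * m ! * (suc m * k * c)
        ≡⟨ rearrange (k ^ m) (m !) (suc m) k c ⟩
      k ^ suc m * suc m ! * c ∎
    where
    open ≡-Reasoning
    rearrange : ∀ a b c d e → a * b * (c * d * e) ≡ d * a * (c * b) * e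
    rearrange = solve-∀

  total : ∀ m b → b ≤ k′ → E (m * k + b) (λ _ → 1) ≡ k ^ m * m !
  total m b b≤k′ = trans (E-top m b b≤k′ (λ _ → 1) 1 (λ _ _ → refl) refl) (*-identityʳ _)

module 231-Count (k′ : ℕ) where
  private k = suc k′
  open Codes (2 ∷ 3 ∷ 1 ∷ []) k
  open Steps (2 ∷ 3 ∷ 1 ∷ []) k
  open 231-Steps k

  -- raney (m − d), with the value 0 if d > m
  raney∸ : ℕ → ℕ → ℕ → ℕ
  raney∸ m       zero    x = raney k′ m x
  raney∸ zero    (suc d) x = 0
  raney∸ (suc m) (suc d) x = raney∸ m d x

  raney∸-suc : ∀ m d x → raney∸ m d (suc x) ≡ raney∸ m d x + raney∸ m (suc d) (x + k)
  raney∸-suc zero    zero    x = refl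
  raney∸-suc (suc m) zero    x = refl
  raney∸-suc zero    (suc d) x = refl
  raney∸-suc (suc m) (suc d) x = raney∸-suc m d x

  raney∸-> : ∀ {m d} x → m < d → raney∸ m d x ≡ 0
  raney∸-> {zero}  {suc d} x _         = refl
  raney∸-> {suc m} {suc d} x (s≤s m<d) = raney∸-> x m<d

  -- With d = n - r, the coefficient of z^m in z^d 𝔅^(b + k′ d). By `count-ending` this is the
  -- number of good permutations ending in r when n = m k + b and b ≤ k′.
  ending : ℕ → ℕ → ℕ → ℕ → ℕ
  ending n m b r = raney∸ m (n ∸ r) (b + k′ * (n ∸ r))

  -- The sum telescopes by 𝔅^(x + 1) = 𝔅^x + z 𝔅^(x + k). At v = 0 the right side vanishes because d
  -- = n + 1 exceeds m.
  ∑-ending : ∀ {n m b} → m ≤ n → ∀ v → v ≤ suc n →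
             ∑[ t < v ] ending n m b (toℕ t) ≡ ending (suc n) m (suc b) v
  ∑-ending m≤n zero _ = sym (raney∸-> _ (s≤s m≤n))
  ∑-ending {n} {m} {b} m≤n (suc v) (s≤s v≤n) = begin
    ∑[ t < suc v ] ending n m b (toℕ t)
      ≡⟨ ∑-last v (ending n m b) ⟩
    ∑[ t < v ] ending n m b (toℕ t) + ending n m b v
      ≡⟨ cong (_+ ending n m b v) (∑-ending m≤n v (m≤n⇒m≤1+n v≤n)) ⟩
    ending (suc n) m (suc b) v + ending n m b v
      ≡⟨ cong (λ a → raney∸ m a (suc b + k′ * a) + ending n m b v) (+-∸-assoc 1 v≤n) ⟩
    raney∸ m (suc d) (suc b + k′ * suc d) + ending n m b v
      ≡⟨ +-comm _ (ending n m b v) ⟩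
    raney∸ m d (b + k′ * d) + raney∸ m (suc d) (suc b + k′ * suc d)
      ≡⟨ cong (λ x → raney∸ m d (b + k′ * d) + raney∸ m (suc d) x) (shift b k′ d) ⟩
    raney∸ m d (b + k′ * d) + raney∸ m (suc d) (b + k′ * d + k)
      ≡⟨ raney∸-suc m d (b + k′ * d) ⟨
    ending (suc n) m (suc b) (suc v) ∎
    where
    open ≡-Reasoning
    d = n ∸ v
    shift : ∀ b k′ d → suc b + k′ * suc d ≡ b + k′ * d + suc k′
    shift = solve-∀

  count-suc : ∀ n (f : ℕ → ℕ) → (∀ r → count n r ≡ f (toℕ r)) → ∀ v →
              count (suc n) v ≡ ∑[ r ≤ n ] (if does (step? r v) then f (toℕ r) else 0)
  count-suc n f eq v = sum-cong-≗ {suc n} λ r → cong (λ a → if does (step? r v) then a else 0) (eq r)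

  count-ending : ∀ m b → b ≤ k′ → ∀ r → count (m * k + b) r ≡ ending (m * k + b) m b (toℕ r)
  count-ending = block-induction k′ (λ n m b → ∀ r → count n r ≡ ending n m b (toℕ r))
    (λ { zero → refl })
    (λ {n} {m} {b} _ ∤n n≡ ih v → trans (count-suc n (ending n m b) ih v)
      (trans (∑-if-below (λ r → step? r v) (ending n m b) (toℕ v) (toℕ≤pred[n] v) (λ r → free-ascent (<ᵇ⇒< 1 3 _) ∤n))
        (∑-ending (subst (m ≤_) (sym n≡) (m≤m*k+b m k′ b)) (toℕ v) (toℕ≤pred[n] v))))
    λ {n} {m} k∣n _ ih v → trans (count-suc n (ending n m k′) ih v) (descent {n} {m} k∣n v)
    where
    descent : ∀ {n m} → k ∣ suc n → ∀ v →
              ∑[ r ≤ n ] (if does (step? r v) then ending n m k′ (toℕ r) else 0) ≡ ending (suc n) (suc m) 0 (toℕ v)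
    descent {n} {m} k∣n v with m≤n⇒m<n∨m≡n (toℕ≤pred[n] v)
    -- The only predecessor is r = v. Both m and d grow by one, so m - d is unchanged, and the
    -- exponent k′ + k′ d is rewritten as k′ (d + 1).
    ... | inj₁ v<n+1 = trans
      (∑-if-single (λ r → step? r v) (ending n m k′) (toℕ v) v<n+1 (λ r → tight-descent k∣n))
      (sym (trans (cong (λ a → raney∸ (suc m) a (k′ * a)) (+-∸-assoc 1 (s≤s⁻¹ v<n+1)))
        (cong (raney∸ m (n ∸ toℕ v)) (*-suc k′ (n ∸ toℕ v)))))
    -- The new maximum has no predecessor; accordingly d = 0 makes the exponent 0, and
    -- `raney k′ (suc m) 0` is 0.
    ... | inj₂ v≡ = trans
      (∑-if-below (λ r → step? r v) (ending n m k′) 0 z≤n λ r → mk⇔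
        (λ s → contradiction (trans (to (tight-descent k∣n) s) v≡) (<⇒≢ (toℕ<n r))) λ ())
      (sym (trans (cong (ending (suc n) (suc m) 0) v≡)
        (trans (cong (λ a → raney∸ (suc m) a (k′ * a)) (n∸n≡0 n)) (cong (raney k′ (suc m)) (*-zeroʳ k′)))))

  total : ∀ m b → b ≤ k′ → E (m * k + b) (λ _ → 1) ≡ raney k′ m (suc b)
  total m b b≤k′ = begin
    E N (λ _ → 1)                               ≡⟨ sum-cong-≗ {suc N} (λ r → trans (*-identityʳ _) (count-ending m b b≤k′ r)) ⟩
    ∑[ t < suc N ] ending N m b (toℕ t)         ≡⟨ ∑-ending (m≤m*k+b m k′ b) (suc N) ≤-refl ⟩
    raney∸ m (N ∸ N) (suc b + k′ * (N ∸ N))     ≡⟨ cong (λ a → raney∸ m a (suc b + k′ * a)) (n∸n≡0 N) ⟩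
    raney k′ m (suc b + k′ * 0)                 ≡⟨ cong (raney k′ m) (trans (cong (suc b +_) (*-zeroʳ k′)) (+-identityʳ (suc b))) ⟩
    raney k′ m (suc b)                          ∎
    where
    open ≡-Reasoning
    N = m * k + b

-- Linear extensions of the block posets

module BlockPosets (k′ m s : ℕ) (2≤k : 2 ≤ suc k′) (s≤k : s ≤ suc k′) where
  private
    k = suc k′
  open Blocks m s k

  suc-a≤k : ∀ {i a q} → X i (suc a) q → suc a ≤ k
  suc-a≤k (inj₁ (_ , _ , _ , a<k) , _) = a<k
  suc-a≤k (inj₂ (_ , _ , a<s) , _)     = ≤-trans a<s s≤k

  -- With `across-next` and the converses `inside-coordinates` and `across-coordinates`, this turns
  -- block coordinates into divisibility: an adjacent pair crosses a block boundary exactly when k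
  -- divides the zero-based right position.
  inside-next : ∀ {i a p q} → X i a p → X i (suc a) q → toℕ q ≡ suc (toℕ p) × ¬ k ∣ toℕ q
  inside-next {i} {zero}  (inj₁ (_ , _ , () , _) , _) _
  inside-next {i} {zero}  (inj₂ (_ , () , _) , _) _
  inside-next {i} {suc a} {p} {q} x@(_ , posp) x⁺@(_ , posq) = trans q≡ (sym posp) , ∤
    where
    q≡ : toℕ q ≡ (i ∸ 1) * k + suc a
    q≡ = suc-injective (trans posq (+-suc ((i ∸ 1) * k) (suc a)))
    ∤ : ¬ k ∣ toℕ q
    ∤ k∣q = >⇒∤ (suc-a≤k x⁺) (∣m+n∣m⇒∣n (subst (k ∣_) q≡ k∣q) (n∣m*n (i ∸ 1)))

  across-next : ∀ {i p q} → 1 ≤ i → X i k p → X (suc i) 1 q → toℕ q ≡ suc (toℕ p) × k ∣ toℕ q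
  across-next {suc i} {p} {q} _ (_ , posp) (_ , posq) =
    trans q≡ (trans (+-comm k (i * k)) (sym posp)) , divides (suc i) q≡
    where
    q≡ : toℕ q ≡ suc i * k
    q≡ = suc-injective (trans posq (+-comm (suc i * k) 1))

  coordinates : ∀ {p} c b → toℕ p ≡ c * k + b → b < k → X (suc c) (suc b) p
  coordinates {p} c b p≡ b<k = place (m≤n⇒m<n∨m≡n c≤m) , trans (cong suc p≡) (sym (+-suc (c * k) b))
    where
    c≤m : c ≤ m
    c≤m = s≤s⁻¹ (*-cancelʳ-< k c (suc m) (begin-strict
      c * k       ≤⟨ m≤m+n (c * k) b ⟩
      c * k + b   ≡⟨ p≡ ⟨
      toℕ p       <⟨ toℕ<n p ⟩
      m * k + s   ≤⟨ +-monoʳ-≤ (m * k) s≤k ⟩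
      m * k + k   ≡⟨ +-comm (m * k) k ⟩
      suc m * k   ∎))
      where open ≤-Reasoning
    place : c < m ⊎ c ≡ m → (1 ≤ suc c × suc c ≤ m × 1 ≤ suc b × suc b ≤ k) ⊎ (suc c ≡ suc m × 1 ≤ suc b × suc b ≤ s)
    place (inj₁ c<m)  = inj₁ (s≤s z≤n , c<m , s≤s z≤n , b<k)
    place (inj₂ refl) = inj₂ (refl , s≤s z≤n , +-cancelˡ-< (m * k) b s (subst (_< N) p≡ (toℕ<n p)))

  div-mod : ∀ n → n ≡ n / k * k + n % k
  div-mod n = trans (m≡m%n+[m/n]*n n k) (+-comm (n % k) _)

  inside-coordinates : ∀ {p q} → toℕ q ≡ suc (toℕ p) → ¬ k ∣ toℕ q → ∃[ i ] ∃[ a ] X i a p × X i (suc a) q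
  inside-coordinates {p} {q} next ∤q with toℕ q % k in rem | div-mod (toℕ q)
  ... | zero  | _  = contradiction (m%n≡0⇒n∣m (toℕ q) k rem) ∤q
  ... | suc b | q≡ = suc c , suc b ,
    coordinates c b (suc-injective (trans (sym next) (trans q≡ (+-suc (c * k) b)))) (<⇒≤ b<k) ,
    coordinates c (suc b) q≡ b<k
    where
    c = toℕ q / k
    b<k : suc b < k
    b<k = subst (_< k) rem (m%n<n (toℕ q) k)

  across-coordinates : ∀ {p q} → toℕ q ≡ suc (toℕ p) → k ∣ toℕ q →
                       ∃[ i ] 1 ≤ i × i ≤ m × X i k p × X (suc i) 1 q
  across-coordinates next (divides zero q≡) = contradiction (trans (sym next) q≡) λ ()
  across-coordinates {p} {q} next (divides (suc c) q≡) = suc c , s≤s z≤n , c<m (proj₁ x) ,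
    coordinates c k′ (suc-injective (trans (sym next) (trans q≡ (cong suc (+-comm k′ (c * k)))))) ≤-refl , x
    where
    x : X (suc (suc c)) 1 q
    x = coordinates (suc c) 0 (trans q≡ (sym (+-identityʳ _))) (s≤s z≤n)
    c<m : _ → suc c ≤ m
    c<m (inj₁ (_ , c<m , _))   = <⇒≤ c<m
    c<m (inj₂ (refl , _ , _)) = ≤-refl

  module _ (p : Vec ℕ 3) where
    open Codes p k

    -- The generators of `B` are the comparisons in `Alternates`: `inside` gives the ascents and
    -- `across` the descents.
    good⇒block : ∀ (w : Fin N → ℕ) → Good w → Ranked BlockRel w
    good⇒block w good (inside x x⁺) with next , ∤q ← inside-next x x⁺ = proj₂ (proj₁ (good next)) ∤q
    good⇒block w good (across 1≤i _ x y) with next , k∣q ← across-next 1≤i y x = proj₁ (proj₁ (good next)) k∣q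

    block⇒alternates : ∀ (w : Fin N → ℕ) → Ranked BlockRel w →
                       ∀ {j j⁺} → toℕ j⁺ ≡ suc (toℕ j) → Alternates (toℕ j⁺) (w j) (w j⁺)
    block⇒alternates w block next =
      (λ k∣ → let _ , 1≤i , i≤m , x , x⁺ = across-coordinates next k∣ in block (across 1≤i i≤m x⁺ x)) ,
      (λ ∤k → let _ , _ , x , x⁺ = inside-coordinates next ∤k in block (inside x x⁺))

  open Codes using (Good)

  -- A descent cannot supply the letters 23, and at an ascent a smaller earlier letter is precisely
  -- an occurrence. Avoidance thus makes every earlier letter larger than the start of the ascent,
  -- equality being excluded by injectivity.
  good-123⇔ : ∀ π → Good (1 ∷ 2 ∷ 3 ∷ []) k (word π) ⇔ (Ranked BlockRel (word π) × Ranked AscentRel (word π))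
  good-123⇔ π = mk⇔ ⇒ ⇐
    where
    w = word π
    ascents : Good (1 ∷ 2 ∷ 3 ∷ []) k w → Ranked AscentRel w
    ascents good (ascent {p = p} {q} {y} x x⁺ y<p) with next , ∤q ← inside-next x x⁺ =
      ≤∧≢⇒< (≮⇒≥ λ wy<wp → proj₂ (good next) y<p
              (sameOrder-sorted wy<wp (proj₂ (proj₁ (good next)) ∤q) (0F ∷ 1F ∷ 2F ∷ [])))
            λ eq → <-irrefl (cong toℕ (sym (word-injective π eq))) y<p
    avoids : Ranked BlockRel w → Ranked AscentRel w → ∀ {j j⁺} → toℕ j⁺ ≡ suc (toℕ j) →
             ∀ {i} → i Fin.< j → ¬ SameOrder (1 ∷ 2 ∷ 3 ∷ []) (w i ∷ w j ∷ w j⁺ ∷ [])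
    avoids block asc {j⁺ = j⁺} next i<j same with k ∣? toℕ j⁺
    ... | yes k∣ = <-asym (to (same 1F 2F) (<ᵇ⇒< 2 3 _)) (proj₁ (block⇒alternates (1 ∷ 2 ∷ 3 ∷ []) (word π) block next) k∣)
    ... | no ∤k with _ , _ , x , x⁺ ← inside-coordinates next ∤k =
      <-asym (to (same 0F 1F) (<ᵇ⇒< 1 2 _)) (asc (ascent x x⁺ i<j))
    ⇒ : Good (1 ∷ 2 ∷ 3 ∷ []) k w → Ranked BlockRel w × Ranked AscentRel w
    ⇒ good = good⇒block (1 ∷ 2 ∷ 3 ∷ []) w good , ascents good
    ⇐ : Ranked BlockRel w × Ranked AscentRel w → Good (1 ∷ 2 ∷ 3 ∷ []) k w
    ⇐ (block , asc) next = block⇒alternates (1 ∷ 2 ∷ 3 ∷ []) w block next , avoids block asc next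

  -- Dually, only a boundary descent supplies the letters 21, and a larger letter before its top is
  -- an occurrence.
  good-321⇔ : ∀ π → Good (3 ∷ 2 ∷ 1 ∷ []) k (word π) ⇔ (Ranked BlockRel (word π) × Ranked DescentRel (word π))
  good-321⇔ π = mk⇔ ⇒ ⇐
    where
    w = word π
    descents : Good (3 ∷ 2 ∷ 1 ∷ []) k w → Ranked DescentRel w
    descents good (descent {p = p} {q} {y} 1≤i _ x x⁺ y<p) with next , k∣q ← across-next 1≤i x x⁺ =
      ≤∧≢⇒< (≮⇒≥ λ wp<wy → proj₂ (good next) y<p
              (sameOrder-sorted (proj₁ (proj₁ (good next)) k∣q) wp<wy (2F ∷ 1F ∷ 0F ∷ [])))
            λ eq → <-irrefl (cong toℕ (word-injective π eq)) y<p
    avoids : Ranked BlockRel w → Ranked DescentRel w → ∀ {j j⁺} → toℕ j⁺ ≡ suc (toℕ j) →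
             ∀ {i} → i Fin.< j → ¬ SameOrder (3 ∷ 2 ∷ 1 ∷ []) (w i ∷ w j ∷ w j⁺ ∷ [])
    avoids block desc {j⁺ = j⁺} next i<j same with k ∣? toℕ j⁺
    ... | no ∤k = <-asym (to (same 2F 1F) (<ᵇ⇒< 1 2 _)) (proj₂ (block⇒alternates (3 ∷ 2 ∷ 1 ∷ []) (word π) block next) ∤k)
    ... | yes k∣ with _ , 1≤i , i≤m , x , x⁺ ← across-coordinates next k∣ =
      <-asym (to (same 1F 0F) (<ᵇ⇒< 2 3 _)) (desc (descent 1≤i i≤m x x⁺ i<j))
    ⇒ : Good (3 ∷ 2 ∷ 1 ∷ []) k w → Ranked BlockRel w × Ranked DescentRel w
    ⇒ good = good⇒block (3 ∷ 2 ∷ 1 ∷ []) w good , descents good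
    ⇐ : Ranked BlockRel w × Ranked DescentRel w → Good (3 ∷ 2 ∷ 1 ∷ []) k w
    ⇐ (block , desc) next = block⇒alternates (3 ∷ 2 ∷ 1 ∷ []) w block next , avoids block desc next

  -- As `<` is transitive, monotonicity need only be checked on generators. The closures are nested
  -- because `addRelations` closes the order of `B` again.
  closure-ranked⇔ : ∀ (R : Rel (Fin N) 0ℓ) (w : Fin N → ℕ) →
    (Ranked BlockRel w × Ranked R w) ⇔ Ranked (TransClosure (TransClosure BlockRel Rel₂.∪ R)) w
  closure-ranked⇔ R w = mk⇔ ⇒ ⇐
    where
    ⇒ : Ranked BlockRel w × Ranked R w → Ranked (TransClosure (TransClosure BlockRel Rel₂.∪ R)) w
    ⇒ (block , added) = closure-ranked {rank = w} λ where
      (inj₁ b) → closure-ranked {rank = w} block b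
      (inj₂ a) → added a
    ⇐ : Ranked (TransClosure (TransClosure BlockRel Rel₂.∪ R)) w → Ranked BlockRel w × Ranked R w
    ⇐ ext = (λ b → ext [ inj₁ [ b ] ]) , (λ a → ext [ inj₂ a ])

  𝓓-123≐ : ∀ small → 𝓓⟨ 1 ∷ 2 ∷ 3 ∷ [] ⟩ N k ≐ LinearExtension (P¹²³ 2≤k s≤k small)
  𝓓-123≐ small =
    (λ {π} d → to (closure-ranked⇔ AscentRel (word π)) (to (good-123⇔ π) (proj₁ (𝓓≐good (1 ∷ 2 ∷ 3 ∷ []) k) {π} d))) ,
    (λ {π} e → proj₂ (𝓓≐good (1 ∷ 2 ∷ 3 ∷ []) k) {π} (from (good-123⇔ π) (from (closure-ranked⇔ AscentRel (word π)) e)))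

  𝓓-321≐ : 𝓓⟨ 3 ∷ 2 ∷ 1 ∷ [] ⟩ N k ≐ LinearExtension (P³²¹′ 2≤k s≤k)
  𝓓-321≐ =
    (λ {π} d → to (closure-ranked⇔ DescentRel (word π)) (to (good-321⇔ π) (proj₁ (𝓓≐good (3 ∷ 2 ∷ 1 ∷ []) k) {π} d))) ,
    (λ {π} e → proj₂ (𝓓≐good (3 ∷ 2 ∷ 1 ∷ []) k) {π} (from (good-321⇔ π) (from (closure-ranked⇔ DescentRel (word π)) e)))

𝓓-123-empty : ∀ N k .{{_ : NonZero k}} → 3 ≤ k → 3 ≤ N → ∀ {π} → ¬ 𝓓⟨ 1 ∷ 2 ∷ 3 ∷ [] ⟩ N k π
-- Neither 1 nor 2 is a multiple of k, so the first three letters ascend and form an occurrence.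
𝓓-123-empty _ k 3≤k (s≤s (s≤s (s≤s _))) {π} d = proj₂ (good {1F} {2F} refl) {0F} (s≤s z≤n)
  (sameOrder-sorted
    (proj₂ (proj₁ (good {0F} {1F} refl)) (>⇒∤ (<⇒≤ 3≤k)))
    (proj₂ (proj₁ (good {1F} {2F} refl)) (>⇒∤ 3≤k))
    (0F ∷ 1F ∷ 2F ∷ []))
  where
  good : Codes.Good (1 ∷ 2 ∷ 3 ∷ []) k (word π)
  good = proj₁ (𝓓≐good (1 ∷ 2 ∷ 3 ∷ []) k) {π} d

theorem5p8 : ∀ (k m s : ℕ) .{{_ : NonZero k}} (2≤k : 2 ≤ k) (1≤s : 1 ≤ s) (s≤k : s ≤ k) →
    let open Blocks m s k in
    ((3 ≤ k × 3 ≤ N → ∣ 𝓓⟨ 1 ∷ 2 ∷ 3 ∷ [] ⟩ N k ∣≡ 0)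
    × ((small : ¬ (3 ≤ k × 3 ≤ N)) →
    ∃[ n ] ∣ 𝓓⟨ 1 ∷ 2 ∷ 3 ∷ [] ⟩ N k ∣≡ n × LE[ P¹²³ 2≤k s≤k small ]≡ n))
    × (∃[ n ] ∣ 𝓓⟨ 1 ∷ 3 ∷ 2 ∷ [] ⟩ N k ∣≡ n
    × m ! * n ≡ ∏[1≤j≤ m ] (λ j → (s + j * k ∸ 1) C k))
    × (∃[ n ] ∣ 𝓓⟨ 2 ∷ 1 ∷ 3 ∷ [] ⟩ N k ∣≡ n
    × ((k ∸ 1) * (m + 1) + 1) * n ≡ (k * (m + 1)) C (m + 1))
    × (∃[ n ] ∣ 𝓓⟨ 2 ∷ 3 ∷ 1 ∷ [] ⟩ N k ∣≡ n
    × N * n ≡ s * (N C m))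
    × (∣ 𝓓⟨ 3 ∷ 1 ∷ 2 ∷ [] ⟩ N k ∣≡ k ^ m * m !)
    × (∃[ n ] ∣ 𝓓⟨ 3 ∷ 2 ∷ 1 ∷ [] ⟩ N k ∣≡ n × LE[ P³²¹′ 2≤k s≤k ]≡ n)
theorem5p8 k@(suc k′) m s@(suc b) 2≤k 1≤s s≤k =
  ( (λ (3≤k , 3≤N) → cardinality (enum-∅ λ {π} → 𝓓-123-empty (m * k + s) k 3≤k 3≤N {π}))
  -- The avoiders and the linear extensions are the same permutations, so one enumeration yields
  -- both cardinalities.
  , (λ small → _ , cardinality (enumeration (1 ∷ 2 ∷ 3 ∷ []))
                 , cardinality (enum-≐ (𝓓-123≐ small) (enumeration (1 ∷ 2 ∷ 3 ∷ [])))))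
  , (_ , counted (1 ∷ 3 ∷ 2 ∷ []) (132-Count.total k′ m b b≤k′) , blocks-closed k′ m b)
  , (_ , counted (2 ∷ 1 ∷ 3 ∷ []) (213-Count.total k′ m b b≤k′) , raney-fuss-catalan k′ m)
  , (_ , counted (2 ∷ 3 ∷ 1 ∷ []) (231-Count.total k′ m b b≤k′) , raney-closed k′ m s)
  , counted (3 ∷ 1 ∷ 2 ∷ []) (312-Count.total k′ (s≤s⁻¹ 2≤k) m b b≤k′)
  , (_ , cardinality (enumeration (3 ∷ 2 ∷ 1 ∷ []))
       , cardinality (enum-≐ 𝓓-321≐ (enumeration (3 ∷ 2 ∷ 1 ∷ []))))
  where
  open Enumeration using (cardinality)
  open BlockPosets k′ m s 2≤k s≤k using (𝓓-123≐; 𝓓-321≐)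

  b≤k′ : b ≤ k′
  b≤k′ = s≤s⁻¹ s≤k

  -- The index of `E` is the size minus one: with s = b + 1, the size m k + s is (m k + b) + 1.
  enumeration : ∀ p → Enumeration (𝓓⟨ p ⟩ (m * k + s) k) (Codes.E p k (m * k + b) (λ _ → 1))
  enumeration p = subst (λ N → Enumeration (𝓓⟨ p ⟩ N k) (Codes.E p k (m * k + b) (λ _ → 1)))
    (sym (+-suc (m * k) b)) (enum-𝓓 p k (m * k + b))

  counted : ∀ p {n} → Codes.E p k (m * k + b) (λ _ → 1) ≡ n → ∣ 𝓓⟨ p ⟩ (m * k + s) k ∣≡ n
  counted p refl = cardinality (enumeration p)
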